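{- Let $d$ be a nonnegative integer and $\delta\in\{0,1\}$. Then $$C_d=(1-2\delta)\sum_{0\le k<d}C_k+(-1)^{\delta}\sum_{i=0}^d\left(\frac{i-\delta}3\right)C_{d,i+1}+1+\delta=\frac12\sum_{j=1}^{d+1}(1-3[3\mid j])C_{d,j}+\frac32.$$ Also, $$\sum_{k=0}^dkC_{d-k}=\sum_{j=1}^{d+1}\left(\frac{j-1}3\right)\left(2\binom{2d}{d-j}-(d+1)C_{d,j}\right)-d=\sum_{j=1}^{d+1}\left(\frac{j+1}3\right)\left(2\binom{2d}{d-j}-(d+1)C_{d,j}\right)+2d+1,$$ and $$\sum_{0<k\le d}\left(k-\frac23\right)C_{d-k}+\frac13\sum_{j=1}^{d+1}jC_{d,j}=\sum_{\substack{1\le j\le d+1\\ j\equiv1\ (\mathrm{mod}\ 3)}}jC_{d,j}-d+\frac23=\sum_{\substack{1\le j\le d+1\\ j\equiv2\ (\mathrm{mod}\ 3)}}jC_{d,j}+2d-\frac13.$$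
   Context: $C_n=\frac1{n+1}\binom{2n}n$ is the $n$-th Catalan number. For $n\in\{0,1,2,\ldots\}$ and $j\in\{0,\ldots,n+1\}$, $C_{n,j}=2\binom{2n}{n-j}-\binom{2n}{n-1-j}-\binom{2n}{n+1-j}$, where $\binom{N}{k}=0$ for $k<0$ or $k>N$. For an integer $a$ (possibly negative), $\left(\frac a3\right)$ is the unique integer in $\{0,\pm1\}$ congruent to $a$ mod $3$. $[A]=1$ if assertion $A$ holds and $0$ otherwise. -}

module Defs where

open import Data.Nat as ℕ using (ℕ; zero; suc; _≤ᵇ_)
open import Data.Nat.Combinatorics using (_C_)
open import Data.Nat.DivMod using (_%_)
open import Data.Integer as ℤ using (ℤ; +_; -[1+_])
open import Data.Integer.DivMod using (_%ℕ_)
open import Data.Rational as ℚ using (ℚ; _/_)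
open import Data.Bool using (if_then_else_)

ι : ℤ → ℚ
ι z = z / 1

binomℤ : ℕ → ℤ → ℤ
binomℤ N (+ k)    = + (N C k)     -- stdlib's _C_ is 0 for k > N
binomℤ N -[1+ _ ] = + 0

catalan : ℕ → ℚ
catalan n = (+ ((2 ℕ.* n) C n)) / suc n

Cnj : ℕ → ℕ → ℤ
Cnj n j = (+ 2) ℤ.* binomℤ (2 ℕ.* n) (+ n ℤ.- + j)
          ℤ.- binomℤ (2 ℕ.* n) (+ n ℤ.- + 1 ℤ.- + j)
          ℤ.- binomℤ (2 ℕ.* n) (+ n ℤ.+ + 1 ℤ.- + j)

leg3 : ℤ → ℤ
leg3 a with a %ℕ 3
... | 0 = + 0
... | 1 = + 1
... | _ = ℤ.- (+ 1)

iv3∣ : ℕ → ℚ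
iv3∣ j = if (j % 3) ℕ.≡ᵇ 0 then ℚ.1ℚ else ℚ.0ℚ

-- sumFT a b f = Σ_{a ≤ k ≤ b} f k  (empty, i.e. 0, if b < a)
sumFT : ℕ → ℕ → (ℕ → ℚ) → ℚ
sumFT a b f = go a (suc b ℕ.∸ a)
  where
  go : ℕ → ℕ → ℚ
  go i zero    = ℚ.0ℚ
  go i (suc m) = f i ℚ.+ go (suc i) m

sumLt : ℕ → (ℕ → ℚ) → ℚ
sumLt zero    f = ℚ.0ℚ
sumLt (suc n) f = sumLt n f ℚ.+ f n

iv≡mod3 : ℕ → ℕ → ℚ
iv≡mod3 r j = if (j % 3) ℕ.≡ᵇ r then ℚ.1ℚ else ℚ.0ℚ

{-# OPTIONS --safe #-}
-- Write b j = binom(2d, d − j), so that C_d = b 0 − b 1 and C_{d,j} = 2 b j − b (j − 1) − b (j + 1).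
-- Summation by parts moves this second difference onto the weight of Σ_{j≥1} w j C_{d,j}. The weights
-- occurring here are 3-periodic with zero sum over a period, possibly multiplied by j, and for those the
-- second difference is 3w, resp. 3jw plus another such periodic weight. Pascal's rule
-- binom(2d+2, d+1−j) = b (j − 1) + 2 b j + b (j + 1) turns every Σ_{j≥1} w j b j into a recursion in d,
-- so that everything reduces to b 0, b 1 and X d = Σ_{j≥1} ((j − 1)/3) b j, with X (d + 1) = X d + b 1.
-- The same recursion gives Σ_{k<d} C_k = b 0 − 1 − 3 X d, and with (d + 1) b 1 = d b 0 all six identities
-- become integer identities between d, b 0, b 1 and X d, which are then carried over to ℚ.
module Submission where

open import Defs
open import Data.Nat as ℕ using (ℕ; suc; _∸_)
open import Data.Integer as ℤ using (ℤ; +_)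
open import Data.Rational as ℚ using (ℚ; _/_)
open import Data.Product using (_×_)
open import Relation.Binary.PropositionalEquality using (_≡_)

open import Data.Nat using (zero; z≤n; s≤s)
open import Data.Integer using (-[1+_])
open import Data.Product using (_,_)
open import Data.Maybe using (Maybe; just; nothing)
open import Relation.Nullary using (yes; no)
open import Relation.Binary.PropositionalEquality using (refl; sym; trans; cong; cong₂; subst; module ≡-Reasoning)
open import Level using (0ℓ)
import Data.Nat.Properties as ℕP
import Data.Integer.Properties as ℤP
import Data.Rational.Properties as ℚP
import Data.Rational.Unnormalised as ℚᵘ
import Data.Rational.Unnormalised.Properties as ℚᵘP
open import Data.Nat.Combinatorics using (_C_; nCk+nC[k+1]≡[n+1]C[k+1]; nCk≡nC[n∸k]; nC1≡n)
open import Data.Integer.Tactic.RingSolver using (solve-∀)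
import Data.Nat.Tactic.RingSolver as ℕ-Solver
import Tactic.RingSolver as ℚ-Solver
import Tactic.RingSolver.Core.AlmostCommutativeRing as ACR

open ≡-Reasoning

cong₃ : ∀ {A B C D : Set} (f : A → B → C → D) {a a′ b b′ c c′} → a ≡ a′ → b ≡ b′ → c ≡ c′ → f a b c ≡ f a′ b′ c′
cong₃ f refl refl refl = refl

∑ : ℕ → (ℕ → ℤ) → ℤ
∑ zero    f = + 0
∑ (suc n) f = ∑ n f ℤ.+ f (suc n)

∑-cong : ∀ n {f g : ℕ → ℤ} → (∀ i → f (suc i) ≡ g (suc i)) → ∑ n f ≡ ∑ n g
∑-cong zero    e = refl
∑-cong (suc n) e = cong₂ ℤ._+_ (∑-cong n e) (e n)

∑-scale : ∀ n a {f h : ℕ → ℤ} → (∀ i → h (suc i) ≡ a ℤ.* f (suc i)) → ∑ n h ≡ a ℤ.* ∑ n f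
∑-scale zero    a e = sym (ℤP.*-zeroʳ a)
∑-scale (suc n) a e = trans (cong₂ ℤ._+_ (∑-scale n a e) (e n)) (sym (ℤP.*-distribˡ-+ a _ _))

∑-linear : ∀ n a b {f g h : ℕ → ℤ} → (∀ i → h (suc i) ≡ a ℤ.* f (suc i) ℤ.+ b ℤ.* g (suc i)) →
           ∑ n h ≡ a ℤ.* ∑ n f ℤ.+ b ℤ.* ∑ n g
∑-linear zero    a b e = zero-combination a b
  where
  zero-combination : ∀ a b → + 0 ≡ a ℤ.* + 0 ℤ.+ b ℤ.* + 0
  zero-combination = solve-∀
∑-linear (suc n) a b e = trans (cong₂ ℤ._+_ (∑-linear n a b e) (e n)) (regroup a b _ _ _ _)
  where
  regroup : ∀ a b x y u v → (a ℤ.* x ℤ.+ b ℤ.* y) ℤ.+ (a ℤ.* u ℤ.+ b ℤ.* v) ≡ a ℤ.* (x ℤ.+ u) ℤ.+ b ℤ.* (y ℤ.+ v)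
  regroup = solve-∀

∑-cons : ∀ n f → ∑ (suc n) f ≡ f 1 ℤ.+ ∑ n (λ j → f (suc j))
∑-cons zero    f = ℤP.+-comm (+ 0) (f 1)
∑-cons (suc n) f = trans (cong (ℤ._+ f (suc (suc n))) (∑-cons n f)) (ℤP.+-assoc (f 1) _ _)

-- ℕ.pred 0 = 0 makes adj f 0 meaningless; adj is only ever evaluated at positive arguments.
adj : (ℕ → ℤ) → ℕ → ℤ
adj f j = f (ℕ.pred j) ℤ.+ f (suc j)

∑-adj : ∀ n (f g : ℕ → ℤ) →
        ∑ n (λ j → f j ℤ.* adj g j) ≡
        ∑ n (λ j → adj f j ℤ.* g j) ℤ.+ (f 1 ℤ.* g 0 ℤ.- f 0 ℤ.* g 1) ℤ.+ (f n ℤ.* g (suc n) ℤ.- f (suc n) ℤ.* g n)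
∑-adj zero    f g = cancel (f 0) (f 1) (g 0) (g 1)
  where
  cancel : ∀ f₀ f₁ g₀ g₁ → + 0 ≡ + 0 ℤ.+ (f₁ ℤ.* g₀ ℤ.- f₀ ℤ.* g₁) ℤ.+ (f₀ ℤ.* g₁ ℤ.- f₁ ℤ.* g₀)
  cancel = solve-∀
∑-adj (suc n) f g =
  trans (cong (ℤ._+ f (suc n) ℤ.* adj g (suc n)) (∑-adj n f g))
        (step (∑ n (λ j → adj f j ℤ.* g j)) (f 1 ℤ.* g 0 ℤ.- f 0 ℤ.* g 1)
              (f n) (f (suc n)) (f (suc (suc n))) (g n) (g (suc n)) (g (suc (suc n))))
  where
  step : ∀ S B f₀ f₁ f₂ g₀ g₁ g₂ →
         S ℤ.+ B ℤ.+ (f₀ ℤ.* g₁ ℤ.- f₁ ℤ.* g₀) ℤ.+ f₁ ℤ.* (g₀ ℤ.+ g₂)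
         ≡ (S ℤ.+ (f₀ ℤ.+ f₂) ℤ.* g₁) ℤ.+ B ℤ.+ (f₁ ℤ.* g₂ ℤ.- f₂ ℤ.* g₁)
  step = solve-∀

binomℤ-pascal : ∀ N k → binomℤ (suc N) k ≡ binomℤ N (k ℤ.- + 1) ℤ.+ binomℤ N k
binomℤ-pascal N (+ zero)  = refl
binomℤ-pascal N (+ suc m) = cong +_ (sym (nCk+nC[k+1]≡[n+1]C[k+1] N m))
binomℤ-pascal N -[1+ m ]  = refl

binomℤ-pascal₂ : ∀ N k →
  binomℤ (suc (suc N)) k ≡ binomℤ N (k ℤ.- + 1 ℤ.- + 1) ℤ.+ + 2 ℤ.* binomℤ N (k ℤ.- + 1) ℤ.+ binomℤ N k
binomℤ-pascal₂ N k = begin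
  binomℤ (suc (suc N)) k
    ≡⟨ binomℤ-pascal (suc N) k ⟩
  binomℤ (suc N) (k ℤ.- + 1) ℤ.+ binomℤ (suc N) k
    ≡⟨ cong₂ ℤ._+_ (binomℤ-pascal N (k ℤ.- + 1)) (binomℤ-pascal N k) ⟩
  (binomℤ N (k ℤ.- + 1 ℤ.- + 1) ℤ.+ binomℤ N (k ℤ.- + 1)) ℤ.+ (binomℤ N (k ℤ.- + 1) ℤ.+ binomℤ N k)
    ≡⟨ collect (binomℤ N (k ℤ.- + 1 ℤ.- + 1)) (binomℤ N (k ℤ.- + 1)) (binomℤ N k) ⟩
  binomℤ N (k ℤ.- + 1 ℤ.- + 1) ℤ.+ + 2 ℤ.* binomℤ N (k ℤ.- + 1) ℤ.+ binomℤ N k ∎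
  where
  collect : ∀ a b c → (a ℤ.+ b) ℤ.+ (b ℤ.+ c) ≡ a ℤ.+ + 2 ℤ.* b ℤ.+ c
  collect = solve-∀

row : ℕ → ℕ → ℤ
row d j = binomℤ (2 ℕ.* d) (+ d ℤ.- + j)

minus-suc : ∀ d j → + d ℤ.- + j ℤ.- + 1 ≡ + d ℤ.- + suc j
minus-suc d j = shift (+ d) (+ j)
  where
  shift : ∀ D J → D ℤ.- J ℤ.- + 1 ≡ D ℤ.- (+ 1 ℤ.+ J)
  shift = solve-∀

row-pascal : ∀ d j → row (suc d) (suc j) ≡ + 2 ℤ.* row d (suc j) ℤ.+ adj (row d) (suc j)
row-pascal d j = begin
  binomℤ (2 ℕ.* suc d) (+ suc d ℤ.- + suc j)
    ≡⟨ cong₂ binomℤ (ℕP.*-suc 2 d) (cancel-suc (+ d) (+ j)) ⟩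
  binomℤ (suc (suc N)) (+ d ℤ.- + j)
    ≡⟨ binomℤ-pascal₂ N (+ d ℤ.- + j) ⟩
  binomℤ N (+ d ℤ.- + j ℤ.- + 1 ℤ.- + 1) ℤ.+ + 2 ℤ.* binomℤ N (+ d ℤ.- + j ℤ.- + 1) ℤ.+ row d j
    ≡⟨ cong₂ (λ x y → binomℤ N x ℤ.+ + 2 ℤ.* binomℤ N y ℤ.+ row d j)
             (trans (cong (ℤ._- + 1) (minus-suc d j)) (minus-suc d (suc j))) (minus-suc d j) ⟩
  row d (suc (suc j)) ℤ.+ + 2 ℤ.* row d (suc j) ℤ.+ row d j
    ≡⟨ reorder (row d (suc (suc j))) (row d (suc j)) (row d j) ⟩
  + 2 ℤ.* row d (suc j) ℤ.+ (row d j ℤ.+ row d (suc (suc j))) ∎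
  where
  N = 2 ℕ.* d
  cancel-suc : ∀ D J → (+ 1 ℤ.+ D) ℤ.- (+ 1 ℤ.+ J) ≡ D ℤ.- J
  cancel-suc = solve-∀
  reorder : ∀ a b c → a ℤ.+ + 2 ℤ.* b ℤ.+ c ≡ + 2 ℤ.* b ℤ.+ (c ℤ.+ a)
  reorder = solve-∀

C-mirror : ∀ a b → (a ℕ.+ b) C a ≡ (a ℕ.+ b) C b
C-mirror a b = trans (nCk≡nC[n∸k] (ℕP.m≤m+n a b)) (cong ((a ℕ.+ b) C_) (ℕP.m+n∸m≡n a b))

C-mirror′ : ∀ {n} a b → n ≡ a ℕ.+ b → n C a ≡ n C b
C-mirror′ a b refl = C-mirror a b

row-mirror : ∀ d → binomℤ (2 ℕ.* d) (+ suc d) ≡ row d 1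
row-mirror zero    = refl
row-mirror (suc e) = cong +_ (C-mirror′ (suc (suc e)) e (split e))
  where
  split : ∀ e → 2 ℕ.* suc e ≡ suc (suc e) ℕ.+ e
  split = ℕ-Solver.solve-∀

row-pascal-centre : ∀ d → row (suc d) 0 ≡ + 2 ℤ.* row d 0 ℤ.+ + 2 ℤ.* row d 1
row-pascal-centre d = begin
  binomℤ (2 ℕ.* suc d) (+ suc d ℤ.- + 0)
    ≡⟨ cong₂ binomℤ (ℕP.*-suc 2 d) (drop-zero (+ d)) ⟩
  binomℤ (suc (suc N)) (+ 1 ℤ.+ + d)
    ≡⟨ binomℤ-pascal₂ N (+ 1 ℤ.+ + d) ⟩
  binomℤ N (+ 1 ℤ.+ + d ℤ.- + 1 ℤ.- + 1) ℤ.+ + 2 ℤ.* binomℤ N (+ 1 ℤ.+ + d ℤ.- + 1) ℤ.+ binomℤ N (+ suc d)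
    ≡⟨ cong₃ (λ x y z → binomℤ N x ℤ.+ + 2 ℤ.* binomℤ N y ℤ.+ z) (down₂ (+ d)) (down₁ (+ d)) (row-mirror d) ⟩
  row d 1 ℤ.+ + 2 ℤ.* row d 0 ℤ.+ row d 1
    ≡⟨ collect (row d 0) (row d 1) ⟩
  + 2 ℤ.* row d 0 ℤ.+ + 2 ℤ.* row d 1 ∎
  where
  N = 2 ℕ.* d
  drop-zero : ∀ D → (+ 1 ℤ.+ D) ℤ.- + 0 ≡ + 1 ℤ.+ D
  drop-zero = solve-∀
  down₂ : ∀ D → + 1 ℤ.+ D ℤ.- + 1 ℤ.- + 1 ≡ D ℤ.- + 1
  down₂ = solve-∀
  down₁ : ∀ D → + 1 ℤ.+ D ℤ.- + 1 ≡ D ℤ.- + 0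
  down₁ = solve-∀
  collect : ∀ a b → b ℤ.+ + 2 ℤ.* a ℤ.+ b ≡ + 2 ℤ.* a ℤ.+ + 2 ℤ.* b
  collect = solve-∀

row-vanishes : ∀ d k → row d (suc (k ℕ.+ d)) ≡ + 0
row-vanishes d k = cong (binomℤ (2 ℕ.* d)) (negative (+ d) (+ k))
  where
  negative : ∀ D K → D ℤ.- (+ 1 ℤ.+ (K ℤ.+ D)) ≡ ℤ.- (+ 1 ℤ.+ K)
  negative = solve-∀

[k+1]*[n+1]C[k+1]≡[n+1]*nCk : ∀ n k → suc k ℕ.* (suc n C suc k) ≡ suc n ℕ.* (n C k)
[k+1]*[n+1]C[k+1]≡[n+1]*nCk zero    zero    = refl
[k+1]*[n+1]C[k+1]≡[n+1]*nCk zero    (suc k) = ℕP.*-zeroʳ (suc (suc k))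
[k+1]*[n+1]C[k+1]≡[n+1]*nCk (suc n) zero    =
  trans (ℕP.+-identityʳ _) (trans (nC1≡n (suc (suc n))) (sym (ℕP.*-identityʳ (suc (suc n)))))
[k+1]*[n+1]C[k+1]≡[n+1]*nCk (suc n) (suc k) = begin
  suc (suc k) ℕ.* (suc (suc n) C suc (suc k))
    ≡⟨ cong (suc (suc k) ℕ.*_) (sym (nCk+nC[k+1]≡[n+1]C[k+1] (suc n) (suc k))) ⟩
  suc (suc k) ℕ.* (X ℕ.+ Y)
    ≡⟨ split k X Y ⟩
  X ℕ.+ suc k ℕ.* X ℕ.+ suc (suc k) ℕ.* Y
    ≡⟨ cong₂ (λ a b → X ℕ.+ a ℕ.+ b)
             ([k+1]*[n+1]C[k+1]≡[n+1]*nCk n k) ([k+1]*[n+1]C[k+1]≡[n+1]*nCk n (suc k)) ⟩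
  X ℕ.+ suc n ℕ.* (n C k) ℕ.+ suc n ℕ.* (n C suc k)
    ≡⟨ join X (suc n) (n C k) (n C suc k) ⟩
  X ℕ.+ suc n ℕ.* (n C k ℕ.+ n C suc k)
    ≡⟨ cong (λ z → X ℕ.+ suc n ℕ.* z) (nCk+nC[k+1]≡[n+1]C[k+1] n k) ⟩
  X ℕ.+ suc n ℕ.* X ∎
  where
  X = suc n C suc k
  Y = suc n C suc (suc k)
  split : ∀ k X Y → (2 ℕ.+ k) ℕ.* (X ℕ.+ Y) ≡ X ℕ.+ (1 ℕ.+ k) ℕ.* X ℕ.+ (2 ℕ.+ k) ℕ.* Y
  split = ℕ-Solver.solve-∀
  join : ∀ X m a b → X ℕ.+ m ℕ.* a ℕ.+ m ℕ.* b ≡ X ℕ.+ m ℕ.* (a ℕ.+ b)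
  join = ℕ-Solver.solve-∀

centre-absorption : ∀ e → suc (suc e) ℕ.* (2 ℕ.* suc e C e) ≡ suc e ℕ.* (2 ℕ.* suc e C suc e)
centre-absorption e =
  subst (λ N → suc (suc e) ℕ.* (N C e) ≡ suc e ℕ.* (N C suc e)) (sym (ℕP.*-suc 2 e)) (begin
  suc (suc e) ℕ.* (suc M C e)            ≡⟨ cong (suc (suc e) ℕ.*_) (C-mirror′ e (suc (suc e)) (split₁ e)) ⟩
  suc (suc e) ℕ.* (suc M C suc (suc e))  ≡⟨ [k+1]*[n+1]C[k+1]≡[n+1]*nCk M (suc e) ⟩
  suc M ℕ.* (M C suc e)                  ≡⟨ cong (suc M ℕ.*_) (C-mirror′ (suc e) e (split₂ e)) ⟩
  suc M ℕ.* (M C e)                      ≡⟨ [k+1]*[n+1]C[k+1]≡[n+1]*nCk M e ⟨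
  suc e ℕ.* (suc M C suc e)              ∎)
  where
  M = suc (2 ℕ.* e)
  split₁ : ∀ e → suc (suc (2 ℕ.* e)) ≡ e ℕ.+ suc (suc e)
  split₁ = ℕ-Solver.solve-∀
  split₂ : ∀ e → suc (2 ℕ.* e) ≡ suc e ℕ.+ e
  split₂ = ℕ-Solver.solve-∀

row-absorption : ∀ d → + suc d ℤ.* row d 1 ≡ + d ℤ.* row d 0
row-absorption zero    = refl
row-absorption (suc e) = begin
  + suc (suc e) ℤ.* + (N C e)             ≡⟨ ℤP.pos-* (suc (suc e)) (N C e) ⟨
  + (suc (suc e) ℕ.* (N C e))             ≡⟨ cong +_ (centre-absorption e) ⟩
  + (suc e ℕ.* (N C suc e))               ≡⟨ cong (λ k → + (suc e ℕ.* (N C k))) (ℕP.+-identityʳ (suc e)) ⟨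
  + (suc e ℕ.* (N C (suc e ℕ.+ 0)))       ≡⟨ ℤP.pos-* (suc e) _ ⟩
  + suc e ℤ.* + (N C (suc e ℕ.+ 0))       ∎
  where
  N = 2 ℕ.* suc e

cancel-absorption : ∀ d E → E ℤ.+ (+ suc d ℤ.* row d 1 ℤ.- + d ℤ.* row d 0) ≡ E
cancel-absorption d E =
  trans (cong (λ t → E ℤ.+ (t ℤ.- + d ℤ.* row d 0)) (row-absorption d)) (cancel E (+ d ℤ.* row d 0))
  where
  cancel : ∀ E x → E ℤ.+ (x ℤ.- x) ≡ E
  cancel = solve-∀

Cnj-row : ∀ d j → Cnj d (suc j) ≡ + 2 ℤ.* row d (suc j) ℤ.- adj (row d) (suc j)
Cnj-row d j =
  trans (cong₂ (λ x y → + 2 ℤ.* row d (suc j) ℤ.- binomℤ (2 ℕ.* d) x ℤ.- binomℤ (2 ℕ.* d) y)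
               (down (+ d) (+ j)) (up (+ d) (+ j)))
        (swap (+ 2 ℤ.* row d (suc j)) (row d (suc (suc j))) (row d j))
  where
  down : ∀ D J → D ℤ.- + 1 ℤ.- (+ 1 ℤ.+ J) ≡ D ℤ.- (+ 1 ℤ.+ (+ 1 ℤ.+ J))
  down = solve-∀
  up : ∀ D J → D ℤ.+ + 1 ℤ.- (+ 1 ℤ.+ J) ≡ D ℤ.- J
  up = solve-∀
  swap : ∀ a b c → a ℤ.- b ℤ.- c ≡ a ℤ.- (c ℤ.+ b)
  swap = solve-∀

rowSum : ℕ → (ℕ → ℤ) → ℤ
rowSum d f = ∑ (suc d) (λ j → f j ℤ.* row d j)

rowSum-cong : ∀ d {f g : ℕ → ℤ} → (∀ i → f (suc i) ≡ g (suc i)) → rowSum d f ≡ rowSum d g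
rowSum-cong d e = ∑-cong (suc d) (λ i → cong (ℤ._* row d (suc i)) (e i))

∑-adj-row : ∀ d f → ∑ (suc d) (λ j → f j ℤ.* adj (row d) j) ≡ rowSum d (adj f) ℤ.+ (f 1 ℤ.* row d 0 ℤ.- f 0 ℤ.* row d 1)
∑-adj-row d f = begin
  ∑ (suc d) (λ j → f j ℤ.* adj (row d) j)
    ≡⟨ ∑-adj (suc d) f (row d) ⟩
  rowSum d (adj f) ℤ.+ B ℤ.+ (f (suc d) ℤ.* row d (suc (suc d)) ℤ.- f (suc (suc d)) ℤ.* row d (suc d))
    ≡⟨ cong₂ (λ x y → rowSum d (adj f) ℤ.+ B ℤ.+ (f (suc d) ℤ.* x ℤ.- f (suc (suc d)) ℤ.* y))
             (row-vanishes d 1) (row-vanishes d 0) ⟩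
  rowSum d (adj f) ℤ.+ B ℤ.+ (f (suc d) ℤ.* + 0 ℤ.- f (suc (suc d)) ℤ.* + 0)
    ≡⟨ vanish (rowSum d (adj f)) B (f (suc d)) (f (suc (suc d))) ⟩
  rowSum d (adj f) ℤ.+ B ∎
  where
  B = f 1 ℤ.* row d 0 ℤ.- f 0 ℤ.* row d 1
  vanish : ∀ S B a b → S ℤ.+ B ℤ.+ (a ℤ.* + 0 ℤ.- b ℤ.* + 0) ≡ S ℤ.+ B
  vanish = solve-∀

rowSum-suc : ∀ d f →
  rowSum (suc d) f ≡ rowSum d (λ j → + 2 ℤ.* f j ℤ.+ adj f j) ℤ.+ (f 1 ℤ.* row d 0 ℤ.- f 0 ℤ.* row d 1)
rowSum-suc d f = begin
  ∑ (suc d) (λ j → f j ℤ.* row (suc d) j) ℤ.+ f (suc (suc d)) ℤ.* row (suc d) (suc (suc d))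
    ≡⟨ cong (λ x → ∑ (suc d) (λ j → f j ℤ.* row (suc d) j) ℤ.+ f (suc (suc d)) ℤ.* x) (row-vanishes (suc d) 0) ⟩
  ∑ (suc d) (λ j → f j ℤ.* row (suc d) j) ℤ.+ f (suc (suc d)) ℤ.* + 0
    ≡⟨ trans (cong (λ x → S ℤ.+ x) (ℤP.*-zeroʳ (f (suc (suc d))))) (ℤP.+-identityʳ S) ⟩
  ∑ (suc d) (λ j → f j ℤ.* row (suc d) j)
    ≡⟨ ∑-linear (suc d) (+ 2) (+ 1) (λ i → trans (cong (f (suc i) ℤ.*_) (row-pascal d i))
                                                 (spread (f (suc i)) (row d (suc i)) (adj (row d) (suc i)))) ⟩
  + 2 ℤ.* rowSum d f ℤ.+ + 1 ℤ.* ∑ (suc d) (λ j → f j ℤ.* adj (row d) j)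
    ≡⟨ cong (λ x → + 2 ℤ.* rowSum d f ℤ.+ + 1 ℤ.* x) (∑-adj-row d f) ⟩
  + 2 ℤ.* rowSum d f ℤ.+ + 1 ℤ.* (rowSum d (adj f) ℤ.+ B)
    ≡⟨ regroup (rowSum d f) (rowSum d (adj f)) B ⟩
  + 2 ℤ.* rowSum d f ℤ.+ + 1 ℤ.* rowSum d (adj f) ℤ.+ B
    ≡⟨ cong (ℤ._+ B) (∑-linear (suc d) (+ 2) (+ 1) (λ i → distrib (f (suc i)) (adj f (suc i)) (row d (suc i)))) ⟨
  rowSum d (λ j → + 2 ℤ.* f j ℤ.+ adj f j) ℤ.+ B ∎
  where
  S = ∑ (suc d) (λ j → f j ℤ.* row (suc d) j)
  B = f 1 ℤ.* row d 0 ℤ.- f 0 ℤ.* row d 1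
  spread : ∀ x y z → x ℤ.* (+ 2 ℤ.* y ℤ.+ z) ≡ + 2 ℤ.* (x ℤ.* y) ℤ.+ + 1 ℤ.* (x ℤ.* z)
  spread = solve-∀
  regroup : ∀ a b B → + 2 ℤ.* a ℤ.+ + 1 ℤ.* (b ℤ.+ B) ≡ + 2 ℤ.* a ℤ.+ + 1 ℤ.* b ℤ.+ B
  regroup = solve-∀
  distrib : ∀ x y r → (+ 2 ℤ.* x ℤ.+ y) ℤ.* r ≡ + 2 ℤ.* (x ℤ.* r) ℤ.+ + 1 ℤ.* (y ℤ.* r)
  distrib = solve-∀

∑-Cnj-by-parts : ∀ d f →
  ∑ (suc d) (λ j → f j ℤ.* Cnj d j) ≡ rowSum d (λ j → + 2 ℤ.* f j ℤ.- adj f j) ℤ.- (f 1 ℤ.* row d 0 ℤ.- f 0 ℤ.* row d 1)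
∑-Cnj-by-parts d f = begin
  ∑ (suc d) (λ j → f j ℤ.* Cnj d j)
    ≡⟨ ∑-linear (suc d) (+ 2) (ℤ.- + 1) (λ i → trans (cong (f (suc i) ℤ.*_) (Cnj-row d i))
                                                     (spread (f (suc i)) (row d (suc i)) (adj (row d) (suc i)))) ⟩
  + 2 ℤ.* rowSum d f ℤ.+ ℤ.- + 1 ℤ.* ∑ (suc d) (λ j → f j ℤ.* adj (row d) j)
    ≡⟨ cong (λ x → + 2 ℤ.* rowSum d f ℤ.+ ℤ.- + 1 ℤ.* x) (∑-adj-row d f) ⟩
  + 2 ℤ.* rowSum d f ℤ.+ ℤ.- + 1 ℤ.* (rowSum d (adj f) ℤ.+ B)
    ≡⟨ regroup (rowSum d f) (rowSum d (adj f)) B ⟩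
  + 2 ℤ.* rowSum d f ℤ.+ ℤ.- + 1 ℤ.* rowSum d (adj f) ℤ.- B
    ≡⟨ cong (ℤ._- B) (∑-linear (suc d) (+ 2) (ℤ.- + 1) (λ i → distrib (f (suc i)) (adj f (suc i)) (row d (suc i)))) ⟨
  rowSum d (λ j → + 2 ℤ.* f j ℤ.- adj f j) ℤ.- B ∎
  where
  B = f 1 ℤ.* row d 0 ℤ.- f 0 ℤ.* row d 1
  spread : ∀ x y z → x ℤ.* (+ 2 ℤ.* y ℤ.- z) ≡ + 2 ℤ.* (x ℤ.* y) ℤ.+ ℤ.- + 1 ℤ.* (x ℤ.* z)
  spread = solve-∀
  regroup : ∀ a b B → + 2 ℤ.* a ℤ.+ ℤ.- + 1 ℤ.* (b ℤ.+ B) ≡ + 2 ℤ.* a ℤ.+ ℤ.- + 1 ℤ.* b ℤ.- B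
  regroup = solve-∀
  distrib : ∀ x y r → (+ 2 ℤ.* x ℤ.- y) ℤ.* r ≡ + 2 ℤ.* (x ℤ.* r) ℤ.+ ℤ.- + 1 ℤ.* (y ℤ.* r)
  distrib = solve-∀

χ : ℕ → ℤ
χ j = leg3 (+ j)

-- χ₋ j = χ (j − 1), written via the period 3 so that it is defined at j = 0.
χ₊ χ₋ : ℕ → ℤ
χ₊ j = χ (suc j)
χ₋ j = χ (suc (suc j))

ZeroSum₃ : (ℕ → ℤ) → Set
ZeroSum₃ p = ∀ i → p i ℤ.+ p (suc i) ℤ.+ p (suc (suc i)) ≡ + 0

χ-zeroSum₃ : ZeroSum₃ χ
χ-zeroSum₃ zero                = refl
χ-zeroSum₃ (suc zero)          = refl
χ-zeroSum₃ (suc (suc zero))    = refl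
χ-zeroSum₃ (suc (suc (suc i))) = χ-zeroSum₃ i

χ₊-zeroSum₃ : ZeroSum₃ χ₊
χ₊-zeroSum₃ i = χ-zeroSum₃ (suc i)

χ₋-zeroSum₃ : ZeroSum₃ χ₋
χ₋-zeroSum₃ i = χ-zeroSum₃ (suc (suc i))

zeroSum₃-− : ∀ p r → ZeroSum₃ p → ZeroSum₃ r → ZeroSum₃ (λ j → p j ℤ.- r j)
zeroSum₃-− p r hp hr i = begin
  (p i ℤ.- r i) ℤ.+ (p (suc i) ℤ.- r (suc i)) ℤ.+ (p (suc (suc i)) ℤ.- r (suc (suc i)))
    ≡⟨ regroup (p i) (p (suc i)) (p (suc (suc i))) (r i) (r (suc i)) (r (suc (suc i))) ⟩
  (p i ℤ.+ p (suc i) ℤ.+ p (suc (suc i))) ℤ.- (r i ℤ.+ r (suc i) ℤ.+ r (suc (suc i)))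
    ≡⟨ cong₂ ℤ._-_ (hp i) (hr i) ⟩
  + 0 ∎
  where
  regroup : ∀ a b c x y z → (a ℤ.- x) ℤ.+ (b ℤ.- y) ℤ.+ (c ℤ.- z) ≡ (a ℤ.+ b ℤ.+ c) ℤ.- (x ℤ.+ y ℤ.+ z)
  regroup = solve-∀

adj-zeroSum₃ : ∀ p → ZeroSum₃ p → ∀ i → adj p (suc i) ≡ ℤ.- p (suc i)
adj-zeroSum₃ p h i = begin
  p i ℤ.+ p (suc (suc i))                              ≡⟨ regroup (p i) (p (suc i)) (p (suc (suc i))) ⟩
  (p i ℤ.+ p (suc i) ℤ.+ p (suc (suc i))) ℤ.- p (suc i) ≡⟨ cong (ℤ._- p (suc i)) (h i) ⟩
  + 0 ℤ.- p (suc i)                                    ≡⟨ ℤP.+-identityˡ _ ⟩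
  ℤ.- p (suc i)                                        ∎
  where
  regroup : ∀ a b c → a ℤ.+ c ≡ (a ℤ.+ b ℤ.+ c) ℤ.- b
  regroup = solve-∀

∂ : (ℕ → ℤ) → ℕ → ℤ
∂ p j = p (suc j) ℤ.- p (ℕ.pred j)

adj-weighted : ∀ p i → adj (λ j → + j ℤ.* p j) (suc i) ≡ + suc i ℤ.* adj p (suc i) ℤ.+ ∂ p (suc i)
adj-weighted p i = product-rule (+ i) (p i) (p (suc (suc i)))
  where
  product-rule : ∀ I a c → I ℤ.* a ℤ.+ (+ 1 ℤ.+ (+ 1 ℤ.+ I)) ℤ.* c ≡ (+ 1 ℤ.+ I) ℤ.* (a ℤ.+ c) ℤ.+ (c ℤ.- a)
  product-rule = solve-∀

module _ (p : ℕ → ℤ) (zero-sum : ZeroSum₃ p) where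

  rowSum-suc-zeroSum₃ : ∀ d → rowSum (suc d) p ≡ rowSum d p ℤ.+ (p 1 ℤ.* row d 0 ℤ.- p 0 ℤ.* row d 1)
  rowSum-suc-zeroSum₃ d = trans (rowSum-suc d p) (cong (ℤ._+ B) (rowSum-cong d {λ j → + 2 ℤ.* p j ℤ.+ adj p j} {p} pointwise))
    where
    B = p 1 ℤ.* row d 0 ℤ.- p 0 ℤ.* row d 1
    halve : ∀ x → + 2 ℤ.* x ℤ.+ ℤ.- x ≡ x
    halve = solve-∀
    pointwise : ∀ i → + 2 ℤ.* p (suc i) ℤ.+ adj p (suc i) ≡ p (suc i)
    pointwise i = trans (cong (λ a → + 2 ℤ.* p (suc i) ℤ.+ a) (adj-zeroSum₃ p zero-sum i)) (halve (p (suc i)))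

  ∑-Cnj-zeroSum₃ : ∀ d → ∑ (suc d) (λ j → p j ℤ.* Cnj d j) ≡ + 3 ℤ.* rowSum d p ℤ.- (p 1 ℤ.* row d 0 ℤ.- p 0 ℤ.* row d 1)
  ∑-Cnj-zeroSum₃ d =
    trans (∑-Cnj-by-parts d p)
          (cong (ℤ._- B) (∑-scale (suc d) (+ 3) {λ j → p j ℤ.* row d j} {λ j → (+ 2 ℤ.* p j ℤ.- adj p j) ℤ.* row d j} pointwise))
    where
    B = p 1 ℤ.* row d 0 ℤ.- p 0 ℤ.* row d 1
    triple : ∀ x r → (+ 2 ℤ.* x ℤ.- ℤ.- x) ℤ.* r ≡ + 3 ℤ.* (x ℤ.* r)
    triple = solve-∀
    pointwise : ∀ i → (+ 2 ℤ.* p (suc i) ℤ.- adj p (suc i)) ℤ.* row d (suc i) ≡ + 3 ℤ.* (p (suc i) ℤ.* row d (suc i))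
    pointwise i = trans (cong (λ a → (+ 2 ℤ.* p (suc i) ℤ.- a) ℤ.* row d (suc i)) (adj-zeroSum₃ p zero-sum i))
                        (triple (p (suc i)) (row d (suc i)))

  rowSum-suc-weighted : ∀ d →
    rowSum (suc d) (λ j → + j ℤ.* p j) ≡ rowSum d (λ j → + j ℤ.* p j) ℤ.+ rowSum d (∂ p) ℤ.+ p 1 ℤ.* row d 0
  rowSum-suc-weighted d = begin
    rowSum (suc d) (λ j → + j ℤ.* p j)
      ≡⟨ rowSum-suc d (λ j → + j ℤ.* p j) ⟩
    rowSum d (λ j → + 2 ℤ.* (+ j ℤ.* p j) ℤ.+ adj (λ j → + j ℤ.* p j) j) ℤ.+ (+ 1 ℤ.* p 1 ℤ.* row d 0 ℤ.- + 0 ℤ.* p 0 ℤ.* row d 1)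
      ≡⟨ cong (ℤ._+ B) (∑-linear (suc d) (+ 1) (+ 1) {λ j → + j ℤ.* p j ℤ.* row d j} {λ j → ∂ p j ℤ.* row d j} pointwise) ⟩
    + 1 ℤ.* rowSum d (λ j → + j ℤ.* p j) ℤ.+ + 1 ℤ.* rowSum d (∂ p) ℤ.+ (+ 1 ℤ.* p 1 ℤ.* row d 0 ℤ.- + 0 ℤ.* p 0 ℤ.* row d 1)
      ≡⟨ simplify (rowSum d (λ j → + j ℤ.* p j)) (rowSum d (∂ p)) (p 1) (p 0) (row d 0) (row d 1) ⟩
    rowSum d (λ j → + j ℤ.* p j) ℤ.+ rowSum d (∂ p) ℤ.+ p 1 ℤ.* row d 0 ∎
    where
    B = + 1 ℤ.* p 1 ℤ.* row d 0 ℤ.- + 0 ℤ.* p 0 ℤ.* row d 1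
    pointwise : ∀ i → (+ 2 ℤ.* (+ suc i ℤ.* p (suc i)) ℤ.+ adj (λ j → + j ℤ.* p j) (suc i)) ℤ.* row d (suc i)
                      ≡ + 1 ℤ.* (+ suc i ℤ.* p (suc i) ℤ.* row d (suc i)) ℤ.+ + 1 ℤ.* (∂ p (suc i) ℤ.* row d (suc i))
    pointwise i = begin
      (+ 2 ℤ.* (+ suc i ℤ.* p (suc i)) ℤ.+ adj (λ j → + j ℤ.* p j) (suc i)) ℤ.* row d (suc i)
        ≡⟨ cong (λ a → (+ 2 ℤ.* (+ suc i ℤ.* p (suc i)) ℤ.+ a) ℤ.* row d (suc i))
                (trans (adj-weighted p i) (cong (λ a → + suc i ℤ.* a ℤ.+ ∂ p (suc i)) (adj-zeroSum₃ p zero-sum i))) ⟩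
      (+ 2 ℤ.* (+ suc i ℤ.* p (suc i)) ℤ.+ (+ suc i ℤ.* ℤ.- p (suc i) ℤ.+ ∂ p (suc i))) ℤ.* row d (suc i)
        ≡⟨ collect (+ suc i) (p (suc i)) (∂ p (suc i)) (row d (suc i)) ⟩
      + 1 ℤ.* (+ suc i ℤ.* p (suc i) ℤ.* row d (suc i)) ℤ.+ + 1 ℤ.* (∂ p (suc i) ℤ.* row d (suc i)) ∎
      where
      collect : ∀ J x c r → (+ 2 ℤ.* (J ℤ.* x) ℤ.+ (J ℤ.* ℤ.- x ℤ.+ c)) ℤ.* r ≡ + 1 ℤ.* (J ℤ.* x ℤ.* r) ℤ.+ + 1 ℤ.* (c ℤ.* r)
      collect = solve-∀
    simplify : ∀ A D x y a b → + 1 ℤ.* A ℤ.+ + 1 ℤ.* D ℤ.+ (+ 1 ℤ.* x ℤ.* a ℤ.- + 0 ℤ.* y ℤ.* b) ≡ A ℤ.+ D ℤ.+ x ℤ.* a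
    simplify = solve-∀

  ∑-Cnj-weighted : ∀ d →
    ∑ (suc d) (λ j → (+ j ℤ.* p j) ℤ.* Cnj d j) ≡ + 3 ℤ.* rowSum d (λ j → + j ℤ.* p j) ℤ.- rowSum d (∂ p) ℤ.- p 1 ℤ.* row d 0
  ∑-Cnj-weighted d = begin
    ∑ (suc d) (λ j → (+ j ℤ.* p j) ℤ.* Cnj d j)
      ≡⟨ ∑-Cnj-by-parts d (λ j → + j ℤ.* p j) ⟩
    rowSum d (λ j → + 2 ℤ.* (+ j ℤ.* p j) ℤ.- adj (λ j → + j ℤ.* p j) j) ℤ.- (+ 1 ℤ.* p 1 ℤ.* row d 0 ℤ.- + 0 ℤ.* p 0 ℤ.* row d 1)
      ≡⟨ cong (ℤ._- B) (∑-linear (suc d) (+ 3) (ℤ.- + 1) {λ j → + j ℤ.* p j ℤ.* row d j} {λ j → ∂ p j ℤ.* row d j} pointwise) ⟩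
    + 3 ℤ.* rowSum d (λ j → + j ℤ.* p j) ℤ.+ ℤ.- + 1 ℤ.* rowSum d (∂ p) ℤ.- (+ 1 ℤ.* p 1 ℤ.* row d 0 ℤ.- + 0 ℤ.* p 0 ℤ.* row d 1)
      ≡⟨ simplify (rowSum d (λ j → + j ℤ.* p j)) (rowSum d (∂ p)) (p 1) (p 0) (row d 0) (row d 1) ⟩
    + 3 ℤ.* rowSum d (λ j → + j ℤ.* p j) ℤ.- rowSum d (∂ p) ℤ.- p 1 ℤ.* row d 0 ∎
    where
    B = + 1 ℤ.* p 1 ℤ.* row d 0 ℤ.- + 0 ℤ.* p 0 ℤ.* row d 1
    pointwise : ∀ i → (+ 2 ℤ.* (+ suc i ℤ.* p (suc i)) ℤ.- adj (λ j → + j ℤ.* p j) (suc i)) ℤ.* row d (suc i)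
                      ≡ + 3 ℤ.* (+ suc i ℤ.* p (suc i) ℤ.* row d (suc i)) ℤ.+ ℤ.- + 1 ℤ.* (∂ p (suc i) ℤ.* row d (suc i))
    pointwise i = begin
      (+ 2 ℤ.* (+ suc i ℤ.* p (suc i)) ℤ.- adj (λ j → + j ℤ.* p j) (suc i)) ℤ.* row d (suc i)
        ≡⟨ cong (λ a → (+ 2 ℤ.* (+ suc i ℤ.* p (suc i)) ℤ.- a) ℤ.* row d (suc i))
                (trans (adj-weighted p i) (cong (λ a → + suc i ℤ.* a ℤ.+ ∂ p (suc i)) (adj-zeroSum₃ p zero-sum i))) ⟩
      (+ 2 ℤ.* (+ suc i ℤ.* p (suc i)) ℤ.- (+ suc i ℤ.* ℤ.- p (suc i) ℤ.+ ∂ p (suc i))) ℤ.* row d (suc i)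
        ≡⟨ collect (+ suc i) (p (suc i)) (∂ p (suc i)) (row d (suc i)) ⟩
      + 3 ℤ.* (+ suc i ℤ.* p (suc i) ℤ.* row d (suc i)) ℤ.+ ℤ.- + 1 ℤ.* (∂ p (suc i) ℤ.* row d (suc i)) ∎
      where
      collect : ∀ J x c r → (+ 2 ℤ.* (J ℤ.* x) ℤ.- (J ℤ.* ℤ.- x ℤ.+ c)) ℤ.* r ≡ + 3 ℤ.* (J ℤ.* x ℤ.* r) ℤ.+ ℤ.- + 1 ℤ.* (c ℤ.* r)
      collect = solve-∀
    simplify : ∀ A D x y a b → + 3 ℤ.* A ℤ.+ ℤ.- + 1 ℤ.* D ℤ.- (+ 1 ℤ.* x ℤ.* a ℤ.- + 0 ℤ.* y ℤ.* b) ≡ + 3 ℤ.* A ℤ.- D ℤ.- x ℤ.* a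
    simplify = solve-∀

rowSum-χ₋-suc : ∀ d → rowSum (suc d) χ₋ ≡ rowSum d χ₋ ℤ.+ row d 1
rowSum-χ₋-suc d =
  trans (rowSum-suc-zeroSum₃ χ₋ χ₋-zeroSum₃ d) (cong (ℤ._+_ (rowSum d χ₋)) (boundary (row d 0) (row d 1)))
  where
  boundary : ∀ a b → + 0 ℤ.* a ℤ.- -[1+ 0 ] ℤ.* b ≡ b
  boundary = solve-∀

rowSum-χ₊ : ∀ d → rowSum d χ₊ ≡ + 1 ℤ.- row d 0 ℤ.+ rowSum d χ₋
rowSum-χ₊ zero    = refl
rowSum-χ₊ (suc d) = begin
  rowSum (suc d) χ₊
    ≡⟨ rowSum-suc-zeroSum₃ χ₊ χ₊-zeroSum₃ d ⟩
  rowSum d χ₊ ℤ.+ (-[1+ 0 ] ℤ.* row d 0 ℤ.- + 1 ℤ.* row d 1)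
    ≡⟨ cong (ℤ._+ (-[1+ 0 ] ℤ.* row d 0 ℤ.- + 1 ℤ.* row d 1)) (rowSum-χ₊ d) ⟩
  + 1 ℤ.- row d 0 ℤ.+ rowSum d χ₋ ℤ.+ (-[1+ 0 ] ℤ.* row d 0 ℤ.- + 1 ℤ.* row d 1)
    ≡⟨ regroup (row d 0) (row d 1) (rowSum d χ₋) ⟩
  + 1 ℤ.- (+ 2 ℤ.* row d 0 ℤ.+ + 2 ℤ.* row d 1) ℤ.+ (rowSum d χ₋ ℤ.+ row d 1)
    ≡⟨ cong₂ (λ a x → + 1 ℤ.- a ℤ.+ x) (row-pascal-centre d) (rowSum-χ₋-suc d) ⟨
  + 1 ℤ.- row (suc d) 0 ℤ.+ rowSum (suc d) χ₋ ∎
  where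
  regroup : ∀ a b X → + 1 ℤ.- a ℤ.+ X ℤ.+ (-[1+ 0 ] ℤ.* a ℤ.- + 1 ℤ.* b) ≡ + 1 ℤ.- (+ 2 ℤ.* a ℤ.+ + 2 ℤ.* b) ℤ.+ (X ℤ.+ b)
  regroup = solve-∀

rowSum-∂χ : ∀ d → rowSum d (∂ χ) ≡ + 1 ℤ.- row d 0
rowSum-∂χ d = begin
  rowSum d (∂ χ)
    ≡⟨ ∑-linear (suc d) (+ 1) (ℤ.- + 1) {λ j → χ₊ j ℤ.* row d j} {λ j → χ₋ j ℤ.* row d j}
                (λ i → split (χ₊ (suc i)) (χ₋ (suc i)) (row d (suc i))) ⟩
  + 1 ℤ.* rowSum d χ₊ ℤ.+ ℤ.- + 1 ℤ.* rowSum d χ₋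
    ≡⟨ cong (λ x → + 1 ℤ.* x ℤ.+ ℤ.- + 1 ℤ.* rowSum d χ₋) (rowSum-χ₊ d) ⟩
  + 1 ℤ.* (+ 1 ℤ.- row d 0 ℤ.+ rowSum d χ₋) ℤ.+ ℤ.- + 1 ℤ.* rowSum d χ₋
    ≡⟨ cancel (row d 0) (rowSum d χ₋) ⟩
  + 1 ℤ.- row d 0 ∎
  where
  split : ∀ a b r → (a ℤ.- b) ℤ.* r ≡ + 1 ℤ.* (a ℤ.* r) ℤ.+ ℤ.- + 1 ℤ.* (b ℤ.* r)
  split = solve-∀
  cancel : ∀ a X → + 1 ℤ.* (+ 1 ℤ.- a ℤ.+ X) ℤ.+ ℤ.- + 1 ℤ.* X ≡ + 1 ℤ.- a
  cancel = solve-∀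

rowSum-jχ : ∀ d → rowSum d (λ j → + j ℤ.* χ j) ≡ + d
rowSum-jχ zero    = refl
rowSum-jχ (suc d) = begin
  rowSum (suc d) (λ j → + j ℤ.* χ j)
    ≡⟨ rowSum-suc-weighted χ χ-zeroSum₃ d ⟩
  rowSum d (λ j → + j ℤ.* χ j) ℤ.+ rowSum d (∂ χ) ℤ.+ + 1 ℤ.* row d 0
    ≡⟨ cong₂ (λ a b → a ℤ.+ b ℤ.+ + 1 ℤ.* row d 0) (rowSum-jχ d) (rowSum-∂χ d) ⟩
  + d ℤ.+ (+ 1 ℤ.- row d 0) ℤ.+ + 1 ℤ.* row d 0
    ≡⟨ cancel (+ d) (row d 0) ⟩
  + 1 ℤ.+ + d ∎
  where
  cancel : ∀ D a → D ℤ.+ (+ 1 ℤ.- a) ℤ.+ + 1 ℤ.* a ≡ + 1 ℤ.+ D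
  cancel = solve-∀

-- 3·[j ≡ 1 (mod 3)] = 1 + ψ j
ψ : ℕ → ℤ
ψ j = χ j ℤ.- χ₊ j

ψ-zeroSum₃ : ZeroSum₃ ψ
ψ-zeroSum₃ = zeroSum₃-− χ χ₊ χ-zeroSum₃ χ₊-zeroSum₃

rowSum-∂ψ : ∀ d → rowSum d (∂ ψ) ≡ ℤ.- + 3 ℤ.* rowSum d χ₋
rowSum-∂ψ d = ∑-scale (suc d) (ℤ.- + 3) {λ j → χ₋ j ℤ.* row d j} {λ j → ∂ ψ j ℤ.* row d j} pointwise
  where
  pointwise : ∀ i → ∂ ψ (suc i) ℤ.* row d (suc i) ≡ ℤ.- + 3 ℤ.* (χ₋ (suc i) ℤ.* row d (suc i))
  pointwise i = begin
    ((c ℤ.- a) ℤ.- (a ℤ.- b)) ℤ.* r             ≡⟨ regroup a b c r ⟩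
    (a ℤ.+ b ℤ.+ c) ℤ.* r ℤ.+ ℤ.- + 3 ℤ.* (a ℤ.* r) ≡⟨ cong (λ s → s ℤ.* r ℤ.+ ℤ.- + 3 ℤ.* (a ℤ.* r)) (χ-zeroSum₃ i) ⟩
    + 0 ℤ.+ ℤ.- + 3 ℤ.* (a ℤ.* r)               ≡⟨ ℤP.+-identityˡ _ ⟩
    ℤ.- + 3 ℤ.* (a ℤ.* r)                       ∎
    where
    a = χ i
    b = χ (suc i)
    c = χ (suc (suc i))
    r = row d (suc i)
    regroup : ∀ a b c r → ((c ℤ.- a) ℤ.- (a ℤ.- b)) ℤ.* r ≡ (a ℤ.+ b ℤ.+ c) ℤ.* r ℤ.+ ℤ.- + 3 ℤ.* (a ℤ.* r)
    regroup = solve-∀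

rowSum-jψ : ∀ d → rowSum d (λ j → + j ℤ.* ψ j) ≡ + d ℤ.* (row d 0 ℤ.- + 3 ℤ.* rowSum d χ₋)
rowSum-jψ zero    = refl
rowSum-jψ (suc d) = begin
  rowSum (suc d) (λ j → + j ℤ.* ψ j)
    ≡⟨ rowSum-suc-weighted ψ ψ-zeroSum₃ d ⟩
  rowSum d (λ j → + j ℤ.* ψ j) ℤ.+ rowSum d (∂ ψ) ℤ.+ + 2 ℤ.* b₀
    ≡⟨ cong₂ (λ a b → a ℤ.+ b ℤ.+ + 2 ℤ.* b₀) (rowSum-jψ d) (rowSum-∂ψ d) ⟩
  + d ℤ.* (b₀ ℤ.- + 3 ℤ.* X) ℤ.+ ℤ.- + 3 ℤ.* X ℤ.+ + 2 ℤ.* b₀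
    ≡⟨ regroup (+ d) b₀ b₁ X ⟩
  E ℤ.+ (+ suc d ℤ.* b₁ ℤ.- + d ℤ.* b₀)
    ≡⟨ cancel-absorption d E ⟩
  + suc d ℤ.* ((+ 2 ℤ.* b₀ ℤ.+ + 2 ℤ.* b₁) ℤ.- + 3 ℤ.* (X ℤ.+ b₁))
    ≡⟨ cong₂ (λ a x → + suc d ℤ.* (a ℤ.- + 3 ℤ.* x)) (row-pascal-centre d) (rowSum-χ₋-suc d) ⟨
  + suc d ℤ.* (row (suc d) 0 ℤ.- + 3 ℤ.* rowSum (suc d) χ₋) ∎
  where
  b₀ = row d 0
  b₁ = row d 1
  X = rowSum d χ₋
  E = + suc d ℤ.* ((+ 2 ℤ.* b₀ ℤ.+ + 2 ℤ.* b₁) ℤ.- + 3 ℤ.* (X ℤ.+ b₁))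
  regroup : ∀ D a b X → D ℤ.* (a ℤ.- + 3 ℤ.* X) ℤ.+ ℤ.- + 3 ℤ.* X ℤ.+ + 2 ℤ.* a
            ≡ (+ 1 ℤ.+ D) ℤ.* ((+ 2 ℤ.* a ℤ.+ + 2 ℤ.* b) ℤ.- + 3 ℤ.* (X ℤ.+ b)) ℤ.+ ((+ 1 ℤ.+ D) ℤ.* b ℤ.- D ℤ.* a)
  regroup = solve-∀

∑-χ₋-Cnj : ∀ d → ∑ (suc d) (λ j → χ₋ j ℤ.* Cnj d j) ≡ + 3 ℤ.* rowSum d χ₋ ℤ.- row d 1
∑-χ₋-Cnj d = trans (∑-Cnj-zeroSum₃ χ₋ χ₋-zeroSum₃ d) (boundary (rowSum d χ₋) (row d 0) (row d 1))
  where
  boundary : ∀ X a b → + 3 ℤ.* X ℤ.- (+ 0 ℤ.* a ℤ.- -[1+ 0 ] ℤ.* b) ≡ + 3 ℤ.* X ℤ.- b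
  boundary = solve-∀

∑-χ₊-Cnj : ∀ d → ∑ (suc d) (λ j → χ₊ j ℤ.* Cnj d j) ≡ + 3 ℤ.* (+ 1 ℤ.- row d 0 ℤ.+ rowSum d χ₋) ℤ.+ row d 0 ℤ.+ row d 1
∑-χ₊-Cnj d = trans (∑-Cnj-zeroSum₃ χ₊ χ₊-zeroSum₃ d)
  (trans (cong (λ s → + 3 ℤ.* s ℤ.- (-[1+ 0 ] ℤ.* row d 0 ℤ.- + 1 ℤ.* row d 1)) (rowSum-χ₊ d))
         (boundary (+ 1 ℤ.- row d 0 ℤ.+ rowSum d χ₋) (row d 0) (row d 1)))
  where
  boundary : ∀ S a b → + 3 ℤ.* S ℤ.- (-[1+ 0 ] ℤ.* a ℤ.- + 1 ℤ.* b) ≡ + 3 ℤ.* S ℤ.+ a ℤ.+ b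
  boundary = solve-∀

∑-jχ-Cnj : ∀ d → ∑ (suc d) (λ j → (+ j ℤ.* χ j) ℤ.* Cnj d j) ≡ + 3 ℤ.* + d ℤ.- + 1
∑-jχ-Cnj d = begin
  ∑ (suc d) (λ j → (+ j ℤ.* χ j) ℤ.* Cnj d j)
    ≡⟨ ∑-Cnj-weighted χ χ-zeroSum₃ d ⟩
  + 3 ℤ.* rowSum d (λ j → + j ℤ.* χ j) ℤ.- rowSum d (∂ χ) ℤ.- + 1 ℤ.* row d 0
    ≡⟨ cong₂ (λ a b → + 3 ℤ.* a ℤ.- b ℤ.- + 1 ℤ.* row d 0) (rowSum-jχ d) (rowSum-∂χ d) ⟩
  + 3 ℤ.* + d ℤ.- (+ 1 ℤ.- row d 0) ℤ.- + 1 ℤ.* row d 0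
    ≡⟨ cancel (+ d) (row d 0) ⟩
  + 3 ℤ.* + d ℤ.- + 1 ∎
  where
  cancel : ∀ D a → + 3 ℤ.* D ℤ.- (+ 1 ℤ.- a) ℤ.- + 1 ℤ.* a ≡ + 3 ℤ.* D ℤ.- + 1
  cancel = solve-∀

∑-jψ-Cnj : ∀ d → ∑ (suc d) (λ j → (+ j ℤ.* ψ j) ℤ.* Cnj d j)
                 ≡ + 3 ℤ.* (+ d ℤ.* (row d 0 ℤ.- + 3 ℤ.* rowSum d χ₋)) ℤ.+ + 3 ℤ.* rowSum d χ₋ ℤ.- + 2 ℤ.* row d 0
∑-jψ-Cnj d = trans (∑-Cnj-weighted ψ ψ-zeroSum₃ d)
  (trans (cong₂ (λ a b → + 3 ℤ.* a ℤ.- b ℤ.- + 2 ℤ.* row d 0) (rowSum-jψ d) (rowSum-∂ψ d))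
         (simplify (+ d ℤ.* (row d 0 ℤ.- + 3 ℤ.* rowSum d χ₋)) (rowSum d χ₋) (row d 0)))
  where
  simplify : ∀ G X a → + 3 ℤ.* G ℤ.- ℤ.- + 3 ℤ.* X ℤ.- + 2 ℤ.* a ≡ + 3 ℤ.* G ℤ.+ + 3 ℤ.* X ℤ.- + 2 ℤ.* a
  simplify = solve-∀

cat : ℕ → ℤ
cat d = row d 0 ℤ.- row d 1

catalanPrefix : ℕ → ℤ
catalanPrefix zero    = + 0
catalanPrefix (suc d) = catalanPrefix d ℤ.+ cat d

convolution : ℕ → ℤ
convolution d = ∑ d (λ k → + k ℤ.* cat (d ∸ k))

∑-cat-reversed : ∀ d → ∑ d (λ k → cat (d ∸ k)) ≡ catalanPrefix d
∑-cat-reversed zero    = refl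
∑-cat-reversed (suc d) = trans (∑-cons d (λ k → cat (suc d ∸ k)))
                               (trans (cong (ℤ._+_ (cat d)) (∑-cat-reversed d)) (ℤP.+-comm (cat d) (catalanPrefix d)))

convolution-suc : ∀ d → convolution (suc d) ≡ convolution d ℤ.+ catalanPrefix (suc d)
convolution-suc d = begin
  ∑ (suc d) (λ k → + k ℤ.* cat (suc d ∸ k))
    ≡⟨ ∑-cons d (λ k → + k ℤ.* cat (suc d ∸ k)) ⟩
  + 1 ℤ.* cat d ℤ.+ ∑ d (λ k → + suc k ℤ.* cat (d ∸ k))
    ≡⟨ cong (ℤ._+_ (+ 1 ℤ.* cat d)) (∑-linear d (+ 1) (+ 1) {λ k → + k ℤ.* cat (d ∸ k)} {λ k → cat (d ∸ k)}
                                             (λ i → split (+ suc i) (cat (d ∸ suc i)))) ⟩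
  + 1 ℤ.* cat d ℤ.+ (+ 1 ℤ.* convolution d ℤ.+ + 1 ℤ.* ∑ d (λ k → cat (d ∸ k)))
    ≡⟨ cong (λ P → + 1 ℤ.* cat d ℤ.+ (+ 1 ℤ.* convolution d ℤ.+ + 1 ℤ.* P)) (∑-cat-reversed d) ⟩
  + 1 ℤ.* cat d ℤ.+ (+ 1 ℤ.* convolution d ℤ.+ + 1 ℤ.* catalanPrefix d)
    ≡⟨ regroup (cat d) (convolution d) (catalanPrefix d) ⟩
  convolution d ℤ.+ (catalanPrefix d ℤ.+ cat d) ∎
  where
  split : ∀ K c → (+ 1 ℤ.+ K) ℤ.* c ≡ + 1 ℤ.* (K ℤ.* c) ℤ.+ + 1 ℤ.* c
  split = solve-∀
  regroup : ∀ c Q P → + 1 ℤ.* c ℤ.+ (+ 1 ℤ.* Q ℤ.+ + 1 ℤ.* P) ≡ Q ℤ.+ (P ℤ.+ c)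
  regroup = solve-∀

catalanPrefix-closed : ∀ d → catalanPrefix d ≡ row d 0 ℤ.- + 1 ℤ.- + 3 ℤ.* rowSum d χ₋
catalanPrefix-closed zero    = refl
catalanPrefix-closed (suc d) = begin
  catalanPrefix d ℤ.+ cat d
    ≡⟨ cong (ℤ._+ cat d) (catalanPrefix-closed d) ⟩
  row d 0 ℤ.- + 1 ℤ.- + 3 ℤ.* rowSum d χ₋ ℤ.+ (row d 0 ℤ.- row d 1)
    ≡⟨ regroup (row d 0) (row d 1) (rowSum d χ₋) ⟩
  (+ 2 ℤ.* row d 0 ℤ.+ + 2 ℤ.* row d 1) ℤ.- + 1 ℤ.- + 3 ℤ.* (rowSum d χ₋ ℤ.+ row d 1)
    ≡⟨ cong₂ (λ a x → a ℤ.- + 1 ℤ.- + 3 ℤ.* x) (row-pascal-centre d) (rowSum-χ₋-suc d) ⟨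
  row (suc d) 0 ℤ.- + 1 ℤ.- + 3 ℤ.* rowSum (suc d) χ₋ ∎
  where
  regroup : ∀ a b X → a ℤ.- + 1 ℤ.- + 3 ℤ.* X ℤ.+ (a ℤ.- b) ≡ (+ 2 ℤ.* a ℤ.+ + 2 ℤ.* b) ℤ.- + 1 ℤ.- + 3 ℤ.* (X ℤ.+ b)
  regroup = solve-∀

convolution-closed : ∀ d → convolution d ≡ + d ℤ.* (row d 0 ℤ.- + 1) ℤ.- (+ 3 ℤ.* + d ℤ.+ + 1) ℤ.* rowSum d χ₋
convolution-closed zero    = refl
convolution-closed (suc d) = begin
  convolution (suc d)
    ≡⟨ convolution-suc d ⟩
  convolution d ℤ.+ catalanPrefix (suc d)
    ≡⟨ cong₂ ℤ._+_ (convolution-closed d) (catalanPrefix-closed (suc d)) ⟩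
  + d ℤ.* (b₀ ℤ.- + 1) ℤ.- (+ 3 ℤ.* + d ℤ.+ + 1) ℤ.* X ℤ.+ (row (suc d) 0 ℤ.- + 1 ℤ.- + 3 ℤ.* rowSum (suc d) χ₋)
    ≡⟨ cong₂ (λ a x → + d ℤ.* (b₀ ℤ.- + 1) ℤ.- (+ 3 ℤ.* + d ℤ.+ + 1) ℤ.* X ℤ.+ (a ℤ.- + 1 ℤ.- + 3 ℤ.* x))
             (row-pascal-centre d) (rowSum-χ₋-suc d) ⟩
  + d ℤ.* (b₀ ℤ.- + 1) ℤ.- (+ 3 ℤ.* + d ℤ.+ + 1) ℤ.* X ℤ.+ ((+ 2 ℤ.* b₀ ℤ.+ + 2 ℤ.* b₁) ℤ.- + 1 ℤ.- + 3 ℤ.* (X ℤ.+ b₁))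
    ≡⟨ regroup (+ d) b₀ b₁ X ⟩
  E ℤ.+ (+ suc d ℤ.* b₁ ℤ.- + d ℤ.* b₀)
    ≡⟨ cancel-absorption d E ⟩
  E
    ≡⟨ cong₂ (λ a x → + suc d ℤ.* (a ℤ.- + 1) ℤ.- (+ 3 ℤ.* + suc d ℤ.+ + 1) ℤ.* x) (row-pascal-centre d) (rowSum-χ₋-suc d) ⟨
  + suc d ℤ.* (row (suc d) 0 ℤ.- + 1) ℤ.- (+ 3 ℤ.* + suc d ℤ.+ + 1) ℤ.* rowSum (suc d) χ₋ ∎
  where
  b₀ = row d 0
  b₁ = row d 1
  X = rowSum d χ₋
  E = + suc d ℤ.* ((+ 2 ℤ.* b₀ ℤ.+ + 2 ℤ.* b₁) ℤ.- + 1) ℤ.- (+ 3 ℤ.* + suc d ℤ.+ + 1) ℤ.* (X ℤ.+ b₁)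
  regroup : ∀ D a b X →
    D ℤ.* (a ℤ.- + 1) ℤ.- (+ 3 ℤ.* D ℤ.+ + 1) ℤ.* X ℤ.+ ((+ 2 ℤ.* a ℤ.+ + 2 ℤ.* b) ℤ.- + 1 ℤ.- + 3 ℤ.* (X ℤ.+ b))
    ≡ ((+ 1 ℤ.+ D) ℤ.* ((+ 2 ℤ.* a ℤ.+ + 2 ℤ.* b) ℤ.- + 1) ℤ.- (+ 3 ℤ.* (+ 1 ℤ.+ D) ℤ.+ + 1) ℤ.* (X ℤ.+ b))
      ℤ.+ ((+ 1 ℤ.+ D) ℤ.* b ℤ.- D ℤ.* a)
  regroup = solve-∀

-- χ (j + 2 − δ) is the symbol ((j − 1 − δ)/3) of the paper.
cat-χ-identity : ∀ d δ → δ ℕ.≤ 1 →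
  cat d ≡ (+ 1 ℤ.- + 2 ℤ.* + δ) ℤ.* catalanPrefix d
          ℤ.+ (ℤ.- + 1) ℤ.^ δ ℤ.* ∑ (suc d) (λ j → χ (suc (suc j) ∸ δ) ℤ.* Cnj d j)
          ℤ.+ (+ 1 ℤ.+ + δ)
cat-χ-identity d .0 z≤n = begin
  row d 0 ℤ.- row d 1
    ≡⟨ expand (row d 0) (row d 1) (rowSum d χ₋) ⟩
  (+ 1 ℤ.- + 2 ℤ.* + 0) ℤ.* (row d 0 ℤ.- + 1 ℤ.- + 3 ℤ.* rowSum d χ₋)
    ℤ.+ (ℤ.- + 1) ℤ.^ 0 ℤ.* (+ 3 ℤ.* rowSum d χ₋ ℤ.- row d 1) ℤ.+ (+ 1 ℤ.+ + 0)
    ≡⟨ cong₂ (λ P S → (+ 1 ℤ.- + 2 ℤ.* + 0) ℤ.* P ℤ.+ (ℤ.- + 1) ℤ.^ 0 ℤ.* S ℤ.+ (+ 1 ℤ.+ + 0))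
             (catalanPrefix-closed d) (∑-χ₋-Cnj d) ⟨
  (+ 1 ℤ.- + 2 ℤ.* + 0) ℤ.* catalanPrefix d ℤ.+ (ℤ.- + 1) ℤ.^ 0 ℤ.* ∑ (suc d) (λ j → χ₋ j ℤ.* Cnj d j) ℤ.+ (+ 1 ℤ.+ + 0) ∎
  where
  expand : ∀ a b X → a ℤ.- b ≡ (+ 1 ℤ.- + 2 ℤ.* + 0) ℤ.* (a ℤ.- + 1 ℤ.- + 3 ℤ.* X)
                               ℤ.+ (ℤ.- + 1) ℤ.^ 0 ℤ.* (+ 3 ℤ.* X ℤ.- b) ℤ.+ (+ 1 ℤ.+ + 0)
  expand = solve-∀
cat-χ-identity d .1 (s≤s z≤n) = begin
  row d 0 ℤ.- row d 1
    ≡⟨ expand (row d 0) (row d 1) (rowSum d χ₋) ⟩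
  (+ 1 ℤ.- + 2 ℤ.* + 1) ℤ.* (row d 0 ℤ.- + 1 ℤ.- + 3 ℤ.* rowSum d χ₋)
    ℤ.+ (ℤ.- + 1) ℤ.^ 1 ℤ.* (+ 3 ℤ.* (+ 1 ℤ.- row d 0 ℤ.+ rowSum d χ₋) ℤ.+ row d 0 ℤ.+ row d 1) ℤ.+ (+ 1 ℤ.+ + 1)
    ≡⟨ cong₂ (λ P S → (+ 1 ℤ.- + 2 ℤ.* + 1) ℤ.* P ℤ.+ (ℤ.- + 1) ℤ.^ 1 ℤ.* S ℤ.+ (+ 1 ℤ.+ + 1))
             (catalanPrefix-closed d) (∑-χ₊-Cnj d) ⟨
  (+ 1 ℤ.- + 2 ℤ.* + 1) ℤ.* catalanPrefix d ℤ.+ (ℤ.- + 1) ℤ.^ 1 ℤ.* ∑ (suc d) (λ j → χ₊ j ℤ.* Cnj d j) ℤ.+ (+ 1 ℤ.+ + 1) ∎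
  where
  expand : ∀ a b X → a ℤ.- b ≡ (+ 1 ℤ.- + 2 ℤ.* + 1) ℤ.* (a ℤ.- + 1 ℤ.- + 3 ℤ.* X)
                               ℤ.+ (ℤ.- + 1) ℤ.^ 1 ℤ.* (+ 3 ℤ.* (+ 1 ℤ.- a ℤ.+ X) ℤ.+ a ℤ.+ b) ℤ.+ (+ 1 ℤ.+ + 1)
  expand = solve-∀

cat-mod3-identity : ∀ d → + 2 ℤ.* cat d ≡ ∑ (suc d) (λ j → (χ₋ j ℤ.- χ₊ j) ℤ.* Cnj d j) ℤ.+ + 3
cat-mod3-identity d = begin
  + 2 ℤ.* (row d 0 ℤ.- row d 1)
    ≡⟨ expand (row d 0) (row d 1) (rowSum d χ₋) ⟩
  + 1 ℤ.* (+ 3 ℤ.* rowSum d χ₋ ℤ.- row d 1)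
    ℤ.+ ℤ.- + 1 ℤ.* (+ 3 ℤ.* (+ 1 ℤ.- row d 0 ℤ.+ rowSum d χ₋) ℤ.+ row d 0 ℤ.+ row d 1) ℤ.+ + 3
    ≡⟨ cong₂ (λ S T → + 1 ℤ.* S ℤ.+ ℤ.- + 1 ℤ.* T ℤ.+ + 3) (∑-χ₋-Cnj d) (∑-χ₊-Cnj d) ⟨
  + 1 ℤ.* ∑ (suc d) (λ j → χ₋ j ℤ.* Cnj d j) ℤ.+ ℤ.- + 1 ℤ.* ∑ (suc d) (λ j → χ₊ j ℤ.* Cnj d j) ℤ.+ + 3
    ≡⟨ cong (ℤ._+ + 3) (∑-linear (suc d) (+ 1) (ℤ.- + 1) {λ j → χ₋ j ℤ.* Cnj d j} {λ j → χ₊ j ℤ.* Cnj d j}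
                                  (λ i → split (χ₋ (suc i)) (χ₊ (suc i)) (Cnj d (suc i)))) ⟨
  ∑ (suc d) (λ j → (χ₋ j ℤ.- χ₊ j) ℤ.* Cnj d j) ℤ.+ + 3 ∎
  where
  expand : ∀ a b X → + 2 ℤ.* (a ℤ.- b) ≡ + 1 ℤ.* (+ 3 ℤ.* X ℤ.- b) ℤ.+ ℤ.- + 1 ℤ.* (+ 3 ℤ.* (+ 1 ℤ.- a ℤ.+ X) ℤ.+ a ℤ.+ b) ℤ.+ + 3
  expand = solve-∀
  split : ∀ a b c → (a ℤ.- b) ℤ.* c ≡ + 1 ℤ.* (a ℤ.* c) ℤ.+ ℤ.- + 1 ℤ.* (b ℤ.* c)
  split = solve-∀

∑-row-Cnj-split : ∀ d w →
  ∑ (suc d) (λ j → w j ℤ.* (+ 2 ℤ.* row d j ℤ.- + suc d ℤ.* Cnj d j))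
  ≡ + 2 ℤ.* rowSum d w ℤ.+ ℤ.- + suc d ℤ.* ∑ (suc d) (λ j → w j ℤ.* Cnj d j)
∑-row-Cnj-split d w = ∑-linear (suc d) (+ 2) (ℤ.- + suc d) {λ j → w j ℤ.* row d j} {λ j → w j ℤ.* Cnj d j}
                                    (λ i → spread (w (suc i)) (row d (suc i)) (+ suc d) (Cnj d (suc i)))
  where
  spread : ∀ w b D c → w ℤ.* (+ 2 ℤ.* b ℤ.- D ℤ.* c) ≡ + 2 ℤ.* (w ℤ.* b) ℤ.+ ℤ.- D ℤ.* (w ℤ.* c)
  spread = solve-∀

convolution-χ₋-identity : ∀ d →
  convolution d ≡ ∑ (suc d) (λ j → χ₋ j ℤ.* (+ 2 ℤ.* row d j ℤ.- + suc d ℤ.* Cnj d j)) ℤ.- + d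
convolution-χ₋-identity d = begin
  convolution d
    ≡⟨ convolution-closed d ⟩
  C
    ≡⟨ cancel-absorption d C ⟨
  C ℤ.+ (+ suc d ℤ.* b₁ ℤ.- + d ℤ.* b₀)
    ≡⟨ regroup (+ d) b₀ b₁ X ⟩
  + 2 ℤ.* X ℤ.+ ℤ.- + suc d ℤ.* (+ 3 ℤ.* X ℤ.- b₁) ℤ.- + d
    ≡⟨ cong (λ S → + 2 ℤ.* X ℤ.+ ℤ.- + suc d ℤ.* S ℤ.- + d) (∑-χ₋-Cnj d) ⟨
  + 2 ℤ.* X ℤ.+ ℤ.- + suc d ℤ.* ∑ (suc d) (λ j → χ₋ j ℤ.* Cnj d j) ℤ.- + d
    ≡⟨ cong (ℤ._- + d) (∑-row-Cnj-split d χ₋) ⟨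
  ∑ (suc d) (λ j → χ₋ j ℤ.* (+ 2 ℤ.* row d j ℤ.- + suc d ℤ.* Cnj d j)) ℤ.- + d ∎
  where
  b₀ = row d 0
  b₁ = row d 1
  X = rowSum d χ₋
  C = + d ℤ.* (b₀ ℤ.- + 1) ℤ.- (+ 3 ℤ.* + d ℤ.+ + 1) ℤ.* X
  regroup : ∀ D a b X → D ℤ.* (a ℤ.- + 1) ℤ.- (+ 3 ℤ.* D ℤ.+ + 1) ℤ.* X ℤ.+ ((+ 1 ℤ.+ D) ℤ.* b ℤ.- D ℤ.* a)
            ≡ + 2 ℤ.* X ℤ.+ ℤ.- (+ 1 ℤ.+ D) ℤ.* (+ 3 ℤ.* X ℤ.- b) ℤ.- D
  regroup = solve-∀

convolution-χ₊-identity : ∀ d →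
  convolution d ≡ ∑ (suc d) (λ j → χ₊ j ℤ.* (+ 2 ℤ.* row d j ℤ.- + suc d ℤ.* Cnj d j)) ℤ.+ + (2 ℕ.* d ℕ.+ 1)
convolution-χ₊-identity d = begin
  convolution d
    ≡⟨ convolution-closed d ⟩
  + d ℤ.* (b₀ ℤ.- + 1) ℤ.- (+ 3 ℤ.* + d ℤ.+ + 1) ℤ.* X
    ≡⟨ regroup (+ d) b₀ b₁ X ⟩
  E ℤ.+ (+ suc d ℤ.* b₁ ℤ.- + d ℤ.* b₀)
    ≡⟨ cancel-absorption d E ⟩
  + 2 ℤ.* Y ℤ.+ ℤ.- + suc d ℤ.* (+ 3 ℤ.* Y ℤ.+ b₀ ℤ.+ b₁) ℤ.+ (+ 2 ℤ.* + d ℤ.+ + 1)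
    ≡⟨ cong₃ (λ R S n → + 2 ℤ.* R ℤ.+ ℤ.- + suc d ℤ.* S ℤ.+ n) (rowSum-χ₊ d) (∑-χ₊-Cnj d) 2d+1 ⟨
  + 2 ℤ.* rowSum d χ₊ ℤ.+ ℤ.- + suc d ℤ.* ∑ (suc d) (λ j → χ₊ j ℤ.* Cnj d j) ℤ.+ + (2 ℕ.* d ℕ.+ 1)
    ≡⟨ cong (ℤ._+ + (2 ℕ.* d ℕ.+ 1)) (∑-row-Cnj-split d χ₊) ⟨
  ∑ (suc d) (λ j → χ₊ j ℤ.* (+ 2 ℤ.* row d j ℤ.- + suc d ℤ.* Cnj d j)) ℤ.+ + (2 ℕ.* d ℕ.+ 1) ∎
  where
  b₀ = row d 0
  b₁ = row d 1
  X = rowSum d χ₋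
  Y = + 1 ℤ.- b₀ ℤ.+ X
  E = + 2 ℤ.* Y ℤ.+ ℤ.- + suc d ℤ.* (+ 3 ℤ.* Y ℤ.+ b₀ ℤ.+ b₁) ℤ.+ (+ 2 ℤ.* + d ℤ.+ + 1)
  2d+1 : + (2 ℕ.* d ℕ.+ 1) ≡ + 2 ℤ.* + d ℤ.+ + 1
  2d+1 = trans (ℤP.pos-+ (2 ℕ.* d) 1) (cong (ℤ._+ + 1) (ℤP.pos-* 2 d))
  regroup : ∀ D a b X → D ℤ.* (a ℤ.- + 1) ℤ.- (+ 3 ℤ.* D ℤ.+ + 1) ℤ.* X
            ≡ (+ 2 ℤ.* (+ 1 ℤ.- a ℤ.+ X) ℤ.+ ℤ.- (+ 1 ℤ.+ D) ℤ.* (+ 3 ℤ.* (+ 1 ℤ.- a ℤ.+ X) ℤ.+ a ℤ.+ b) ℤ.+ (+ 2 ℤ.* D ℤ.+ + 1))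
              ℤ.+ ((+ 1 ℤ.+ D) ℤ.* b ℤ.- D ℤ.* a)
  regroup = solve-∀

convolution-ψ-identity : ∀ d →
  + 3 ℤ.* convolution d ℤ.- + 2 ℤ.* catalanPrefix d ≡ ∑ (suc d) (λ j → (+ j ℤ.* ψ j) ℤ.* Cnj d j) ℤ.+ (+ 2 ℤ.- + 3 ℤ.* + d)
convolution-ψ-identity d = begin
  + 3 ℤ.* convolution d ℤ.- + 2 ℤ.* catalanPrefix d
    ≡⟨ cong₂ (λ Q P → + 3 ℤ.* Q ℤ.- + 2 ℤ.* P) (convolution-closed d) (catalanPrefix-closed d) ⟩
  + 3 ℤ.* (+ d ℤ.* (row d 0 ℤ.- + 1) ℤ.- (+ 3 ℤ.* + d ℤ.+ + 1) ℤ.* rowSum d χ₋) ℤ.- + 2 ℤ.* (row d 0 ℤ.- + 1 ℤ.- + 3 ℤ.* rowSum d χ₋)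
    ≡⟨ regroup (+ d) (row d 0) (rowSum d χ₋) ⟩
  + 3 ℤ.* (+ d ℤ.* (row d 0 ℤ.- + 3 ℤ.* rowSum d χ₋)) ℤ.+ + 3 ℤ.* rowSum d χ₋ ℤ.- + 2 ℤ.* row d 0 ℤ.+ (+ 2 ℤ.- + 3 ℤ.* + d)
    ≡⟨ cong (ℤ._+ (+ 2 ℤ.- + 3 ℤ.* + d)) (∑-jψ-Cnj d) ⟨
  ∑ (suc d) (λ j → (+ j ℤ.* ψ j) ℤ.* Cnj d j) ℤ.+ (+ 2 ℤ.- + 3 ℤ.* + d) ∎
  where
  regroup : ∀ D a X → + 3 ℤ.* (D ℤ.* (a ℤ.- + 1) ℤ.- (+ 3 ℤ.* D ℤ.+ + 1) ℤ.* X) ℤ.- + 2 ℤ.* (a ℤ.- + 1 ℤ.- + 3 ℤ.* X)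
                      ≡ + 3 ℤ.* (D ℤ.* (a ℤ.- + 3 ℤ.* X)) ℤ.+ + 3 ℤ.* X ℤ.- + 2 ℤ.* a ℤ.+ (+ 2 ℤ.- + 3 ℤ.* D)
  regroup = solve-∀

-- 3·[j ≡ 2 (mod 3)] = 1 + ψ j − 3 χ j
convolution-ψχ-identity : ∀ d →
  + 3 ℤ.* convolution d ℤ.- + 2 ℤ.* catalanPrefix d
  ≡ ∑ (suc d) (λ j → (+ j ℤ.* (ψ j ℤ.- + 3 ℤ.* χ j)) ℤ.* Cnj d j) ℤ.+ (+ 3 ℤ.* + (2 ℕ.* d) ℤ.- + 1)
convolution-ψχ-identity d = begin
  + 3 ℤ.* convolution d ℤ.- + 2 ℤ.* catalanPrefix d
    ≡⟨ convolution-ψ-identity d ⟩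
  Sψ ℤ.+ (+ 2 ℤ.- + 3 ℤ.* + d)
    ≡⟨ regroup Sψ (+ d) ⟩
  + 1 ℤ.* Sψ ℤ.+ ℤ.- + 3 ℤ.* (+ 3 ℤ.* + d ℤ.- + 1) ℤ.+ (+ 3 ℤ.* (+ 2 ℤ.* + d) ℤ.- + 1)
    ≡⟨ cong₂ (λ S n → + 1 ℤ.* Sψ ℤ.+ ℤ.- + 3 ℤ.* S ℤ.+ (+ 3 ℤ.* n ℤ.- + 1)) (∑-jχ-Cnj d) (ℤP.pos-* 2 d) ⟨
  + 1 ℤ.* Sψ ℤ.+ ℤ.- + 3 ℤ.* ∑ (suc d) (λ j → (+ j ℤ.* χ j) ℤ.* Cnj d j) ℤ.+ (+ 3 ℤ.* + (2 ℕ.* d) ℤ.- + 1)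
    ≡⟨ cong (ℤ._+ (+ 3 ℤ.* + (2 ℕ.* d) ℤ.- + 1))
            (∑-linear (suc d) (+ 1) (ℤ.- + 3) {λ j → (+ j ℤ.* ψ j) ℤ.* Cnj d j} {λ j → (+ j ℤ.* χ j) ℤ.* Cnj d j}
                      (λ i → split (+ suc i) (ψ (suc i)) (χ (suc i)) (Cnj d (suc i)))) ⟨
  ∑ (suc d) (λ j → (+ j ℤ.* (ψ j ℤ.- + 3 ℤ.* χ j)) ℤ.* Cnj d j) ℤ.+ (+ 3 ℤ.* + (2 ℕ.* d) ℤ.- + 1) ∎
  where
  Sψ = ∑ (suc d) (λ j → (+ j ℤ.* ψ j) ℤ.* Cnj d j)
  regroup : ∀ S D → S ℤ.+ (+ 2 ℤ.- + 3 ℤ.* D) ≡ + 1 ℤ.* S ℤ.+ ℤ.- + 3 ℤ.* (+ 3 ℤ.* D ℤ.- + 1) ℤ.+ (+ 3 ℤ.* (+ 2 ℤ.* D) ℤ.- + 1)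
  regroup = solve-∀
  split : ∀ J a c C → (J ℤ.* (a ℤ.- + 3 ℤ.* c)) ℤ.* C ≡ + 1 ℤ.* (J ℤ.* a ℤ.* C) ℤ.+ ℤ.- + 3 ℤ.* (J ℤ.* c ℤ.* C)
  split = solve-∀

ι-toℚᵘ : ∀ z → ℚ.toℚᵘ (ι z) ℚᵘ.≃ ℚᵘ.mkℚᵘ z 0
ι-toℚᵘ z = ℚP.toℚᵘ-fromℚᵘ (ℚᵘ.mkℚᵘ z 0)

ι-+ : ∀ a b → ι (a ℤ.+ b) ≡ ι a ℚ.+ ι b
ι-+ a b = ℚP.toℚᵘ-injective (ℚᵘP.≃-trans (ι-toℚᵘ (a ℤ.+ b)) (ℚᵘP.≃-trans (ℚᵘ.*≡* (cross a b))
            (ℚᵘP.≃-sym (ℚᵘP.≃-trans (ℚP.toℚᵘ-homo-+ (ι a) (ι b)) (ℚᵘP.+-cong (ι-toℚᵘ a) (ι-toℚᵘ b))))))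
  where
  cross : ∀ a b → (a ℤ.+ b) ℤ.* + 1 ≡ (a ℤ.* + 1 ℤ.+ b ℤ.* + 1) ℤ.* + 1
  cross = solve-∀

ι-* : ∀ a b → ι (a ℤ.* b) ≡ ι a ℚ.* ι b
ι-* a b = ℚP.toℚᵘ-injective (ℚᵘP.≃-trans (ι-toℚᵘ (a ℤ.* b))
            (ℚᵘP.≃-sym (ℚᵘP.≃-trans (ℚP.toℚᵘ-homo-* (ι a) (ι b)) (ℚᵘP.*-cong (ι-toℚᵘ a) (ι-toℚᵘ b)))))

ι-- : ∀ a b → ι (a ℤ.- b) ≡ ι a ℚ.- ι b
ι-- a b = trans (ι-+ a (ℤ.- b)) (cong (ι a ℚ.+_) (ℚP.toℚᵘ-injective (ℚᵘP.≃-trans (ι-toℚᵘ (ℤ.- b))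
            (ℚᵘP.≃-sym (ℚᵘP.≃-trans (ℚP.toℚᵘ-homo‿- (ι b)) (ℚᵘP.-‿cong (ι-toℚᵘ b)))))))

ι-combination : ∀ A P B S C → ι (A ℤ.* P ℤ.+ B ℤ.* S ℤ.+ C) ≡ ι A ℚ.* ι P ℚ.+ ι B ℚ.* ι S ℚ.+ ι C
ι-combination A P B S C =
  trans (ι-+ (A ℤ.* P ℤ.+ B ℤ.* S) C) (cong (ℚ._+ ι C) (trans (ι-+ (A ℤ.* P) (B ℤ.* S)) (cong₂ ℚ._+_ (ι-* A P) (ι-* B S))))

third : ℤ → ℚ
third z = (+ 1 / 3) ℚ.* ι z

third-+ : ∀ a b → third (a ℤ.+ b) ≡ third a ℚ.+ third b
third-+ a b = trans (cong ((+ 1 / 3) ℚ.*_) (ι-+ a b)) (ℚP.*-distribˡ-+ (+ 1 / 3) (ι a) (ι b))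

ℚ-ring : ACR.AlmostCommutativeRing 0ℓ 0ℓ
ℚ-ring = ACR.fromCommutativeRing ℚP.+-*-commutativeRing is-zero
  where
  is-zero : ∀ x → Maybe (ℚ.0ℚ ≡ x)
  is-zero x with ℚ.0ℚ ℚP.≟ x
  ... | yes p = just p
  ... | no _  = nothing

sumFT-cons : ∀ {a b} f → a ℕ.≤ b → sumFT a b f ≡ f a ℚ.+ sumFT (suc a) b f
sumFT-cons f a≤b rewrite ℕP.+-∸-assoc 1 a≤b = refl

sumFT-empty : ∀ a f → sumFT (suc a) a f ≡ ℚ.0ℚ
sumFT-empty a f rewrite ℕP.n∸n≡0 a = refl

module _ (h : ℤ → ℚ) (h-0 : h (+ 0) ≡ ℚ.0ℚ) (h-+ : ∀ x y → h (x ℤ.+ y) ≡ h x ℚ.+ h y) where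

  private
    sumFT-∑-from : ∀ m a {f g} → (∀ i → f (suc (i ℕ.+ a)) ≡ h (g (suc i))) → sumFT (suc a) (m ℕ.+ a) f ≡ h (∑ m g)
    sumFT-∑-from zero    a {f}     e = trans (sumFT-empty a f) (sym h-0)
    sumFT-∑-from (suc m) a {f} {g} e = begin
      sumFT (suc a) (suc (m ℕ.+ a)) f
        ≡⟨ sumFT-cons f (s≤s (ℕP.m≤n+m a m)) ⟩
      f (suc a) ℚ.+ sumFT (suc (suc a)) (suc (m ℕ.+ a)) f
        ≡⟨ cong (f (suc a) ℚ.+_) (cong (λ b → sumFT (suc (suc a)) b f) (ℕP.+-suc m a)) ⟨
      f (suc a) ℚ.+ sumFT (suc (suc a)) (m ℕ.+ suc a) f
        ≡⟨ cong₂ ℚ._+_ (e 0) (sumFT-∑-from m (suc a) (λ i → trans (cong (λ k → f (suc k)) (ℕP.+-suc i a)) (e (suc i)))) ⟩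
      h (g 1) ℚ.+ h (∑ m (λ j → g (suc j)))
        ≡⟨ trans (cong h (∑-cons m g)) (h-+ (g 1) (∑ m (λ j → g (suc j)))) ⟨
      h (∑ (suc m) g) ∎

  sumFT-∑ : ∀ n f g → (∀ i → f (suc i) ≡ h (g (suc i))) → sumFT 1 n f ≡ h (∑ n g)
  sumFT-∑ n f g e = trans (cong (λ b → sumFT 1 b f) (sym (ℕP.+-identityʳ n)))
                          (sumFT-∑-from n 0 (λ i → trans (cong (λ k → f (suc k)) (ℕP.+-identityʳ i)) (e i)))

sumFT-ι : ∀ n f g → (∀ i → f (suc i) ≡ ι (g (suc i))) → sumFT 1 n f ≡ ι (∑ n g)
sumFT-ι = sumFT-∑ ι refl ι-+

sumFT-third : ∀ n f g → (∀ i → f (suc i) ≡ third (g (suc i))) → sumFT 1 n f ≡ third (∑ n g)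
sumFT-third = sumFT-∑ third refl third-+

sumFT₀-ι : ∀ d f H → (∀ i → f i ≡ ι (H (suc i))) → sumFT 0 d f ≡ ι (∑ (suc d) H)
sumFT₀-ι d f H e = begin
  sumFT 0 d f                                  ≡⟨ sumFT-cons {0} {d} f z≤n ⟩
  f 0 ℚ.+ sumFT 1 d f                          ≡⟨ cong₂ ℚ._+_ (e 0) (sumFT-ι d f (λ j → H (suc j)) (λ i → e (suc i))) ⟩
  ι (H 1) ℚ.+ ι (∑ d (λ j → H (suc j)))        ≡⟨ trans (cong ι (∑-cons d H)) (ι-+ (H 1) (∑ d (λ j → H (suc j)))) ⟨
  ι (∑ (suc d) H)                              ∎

catalan≡ι-cat : ∀ d → catalan d ≡ ι (cat d)
catalan≡ι-cat d = ℚP.fromℚᵘ-cong {ℚᵘ.mkℚᵘ (+ (2 ℕ.* d C d)) d} {ℚᵘ.mkℚᵘ (cat d) 0} (ℚᵘ.*≡* (begin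
  + (2 ℕ.* d C d) ℤ.* + 1                  ≡⟨ cong (λ k → + (2 ℕ.* d C k) ℤ.* + 1) (ℕP.+-identityʳ d) ⟨
  b₀ ℤ.* + 1                                ≡⟨ regroup (+ d) b₀ b₁ ⟩
  E ℤ.+ (+ suc d ℤ.* b₁ ℤ.- + d ℤ.* b₀)     ≡⟨ cancel-absorption d E ⟩
  E                                         ∎))
  where
  b₀ = row d 0
  b₁ = row d 1
  E = (b₀ ℤ.- b₁) ℤ.* (+ 1 ℤ.+ + d)
  regroup : ∀ D a b → a ℤ.* + 1 ≡ (a ℤ.- b) ℤ.* (+ 1 ℤ.+ D) ℤ.+ ((+ 1 ℤ.+ D) ℤ.* b ℤ.- D ℤ.* a)
  regroup = solve-∀

sumLt-catalan : ∀ d → sumLt d catalan ≡ ι (catalanPrefix d)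
sumLt-catalan zero    = refl
sumLt-catalan (suc d) = trans (cong₂ ℚ._+_ (sumLt-catalan d) (catalan≡ι-cat d)) (sym (ι-+ (catalanPrefix d) (cat d)))

sumFT-convolution : ∀ d → sumFT 0 d (λ k → ι (+ k) ℚ.* catalan (d ∸ k)) ≡ ι (convolution d)
sumFT-convolution d = begin
  sumFT 0 d f                    ≡⟨ sumFT-cons {0} {d} f z≤n ⟩
  ι (+ 0) ℚ.* catalan d ℚ.+ sumFT 1 d f
    ≡⟨ trans (cong (ℚ._+ sumFT 1 d f) (ℚP.*-zeroˡ (catalan d))) (ℚP.+-identityˡ (sumFT 1 d f)) ⟩
  sumFT 1 d f                    ≡⟨ sumFT-ι d f (λ k → + k ℤ.* cat (d ∸ k)) (λ i →
                                      trans (cong (ι (+ suc i) ℚ.*_) (catalan≡ι-cat (d ∸ suc i))) (sym (ι-* (+ suc i) (cat (d ∸ suc i))))) ⟩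
  ι (convolution d)              ∎
  where
  f = λ k → ι (+ k) ℚ.* catalan (d ∸ k)

leg3-shift : ∀ δ → δ ℕ.≤ 1 → ∀ i → leg3 (+ i ℤ.- + δ) ≡ χ (suc (suc (suc i)) ∸ δ)
leg3-shift .0 z≤n       i       = cong leg3 (ℤP.+-identityʳ (+ i))
leg3-shift .1 (s≤s z≤n) zero    = refl
leg3-shift .1 (s≤s z≤n) (suc i) = refl

leg3-+1 : ∀ j → leg3 (+ j ℤ.+ + 1) ≡ χ₊ j
leg3-+1 j = cong (λ k → leg3 (+ k)) (ℕP.+-comm j 1)

iv3∣-weight : ∀ j → ℚ.1ℚ ℚ.- ι (+ 3) ℚ.* iv3∣ j ≡ ι (χ₋ j ℤ.- χ₊ j)
iv3∣-weight zero                = refl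
iv3∣-weight (suc zero)          = refl
iv3∣-weight (suc (suc zero))    = refl
iv3∣-weight (suc (suc (suc j))) = iv3∣-weight j

iv≡mod3-1-weight : ∀ j → iv≡mod3 1 j ≡ third (+ 1 ℤ.+ ψ j)
iv≡mod3-1-weight zero                = refl
iv≡mod3-1-weight (suc zero)          = refl
iv≡mod3-1-weight (suc (suc zero))    = refl
iv≡mod3-1-weight (suc (suc (suc j))) = iv≡mod3-1-weight j

iv≡mod3-2-weight : ∀ j → iv≡mod3 2 j ≡ third (+ 1 ℤ.+ (ψ j ℤ.- + 3 ℤ.* χ j))
iv≡mod3-2-weight zero                = refl
iv≡mod3-2-weight (suc zero)          = refl
iv≡mod3-2-weight (suc (suc zero))    = refl
iv≡mod3-2-weight (suc (suc (suc j))) = iv≡mod3-2-weight j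

catalan-χ-identity : ∀ d δ → δ ℕ.≤ 1 →
  catalan d ≡ ι (+ 1 ℤ.- + 2 ℤ.* + δ) ℚ.* sumLt d catalan
              ℚ.+ ι ((ℤ.- + 1) ℤ.^ δ) ℚ.* sumFT 0 d (λ i → ι (leg3 (+ i ℤ.- + δ) ℤ.* Cnj d (suc i)))
              ℚ.+ ι (+ 1 ℤ.+ + δ)
catalan-χ-identity d δ δ≤1 = begin
  catalan d
    ≡⟨ catalan≡ι-cat d ⟩
  ι (cat d)
    ≡⟨ cong ι (cat-χ-identity d δ δ≤1) ⟩
  ι (A ℤ.* catalanPrefix d ℤ.+ B ℤ.* S ℤ.+ C)
    ≡⟨ ι-combination A (catalanPrefix d) B S C ⟩
  ι A ℚ.* ι (catalanPrefix d) ℚ.+ ι B ℚ.* ι S ℚ.+ ι C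
    ≡⟨ cong₂ (λ x y → ι A ℚ.* x ℚ.+ ι B ℚ.* y ℚ.+ ι C) (sumLt-catalan d)
             (sumFT₀-ι d F H (λ i → cong (λ w → ι (w ℤ.* Cnj d (suc i))) (leg3-shift δ δ≤1 i))) ⟨
  ι A ℚ.* sumLt d catalan ℚ.+ ι B ℚ.* sumFT 0 d (λ i → ι (leg3 (+ i ℤ.- + δ) ℤ.* Cnj d (suc i))) ℚ.+ ι C ∎
  where
  A = + 1 ℤ.- + 2 ℤ.* + δ
  B = (ℤ.- + 1) ℤ.^ δ
  C = + 1 ℤ.+ + δ
  F = λ i → ι (leg3 (+ i ℤ.- + δ) ℤ.* Cnj d (suc i))
  H = λ j → χ (suc (suc j) ∸ δ) ℤ.* Cnj d j
  S = ∑ (suc d) H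

catalan-mod3-identity : ∀ d →
  catalan d ≡ (+ 1 / 2) ℚ.* sumFT 1 (suc d) (λ j → (ℚ.1ℚ ℚ.- ι (+ 3) ℚ.* iv3∣ j) ℚ.* ι (Cnj d j)) ℚ.+ (+ 3 / 2)
catalan-mod3-identity d = begin
  catalan d
    ≡⟨ catalan≡ι-cat d ⟩
  ι (cat d)
    ≡⟨ halve (ι (cat d)) ⟩
  (+ 1 / 2) ℚ.* (ι (+ 2) ℚ.* ι (cat d))
    ≡⟨ cong ((+ 1 / 2) ℚ.*_) (trans (sym (ι-* (+ 2) (cat d))) (trans (cong ι (cat-mod3-identity d)) (ι-+ S (+ 3)))) ⟩
  (+ 1 / 2) ℚ.* (ι S ℚ.+ ι (+ 3))
    ≡⟨ distribute (ι S) ⟩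
  (+ 1 / 2) ℚ.* ι S ℚ.+ (+ 3 / 2)
    ≡⟨ cong (λ x → (+ 1 / 2) ℚ.* x ℚ.+ (+ 3 / 2)) (sumFT-ι (suc d) F G (λ i →
         trans (cong (ℚ._* ι (Cnj d (suc i))) (iv3∣-weight (suc i))) (sym (ι-* (χ₋ (suc i) ℤ.- χ₊ (suc i)) (Cnj d (suc i)))))) ⟨
  (+ 1 / 2) ℚ.* sumFT 1 (suc d) (λ j → (ℚ.1ℚ ℚ.- ι (+ 3) ℚ.* iv3∣ j) ℚ.* ι (Cnj d j)) ℚ.+ (+ 3 / 2) ∎
  where
  F = λ j → (ℚ.1ℚ ℚ.- ι (+ 3) ℚ.* iv3∣ j) ℚ.* ι (Cnj d j)
  G = λ j → (χ₋ j ℤ.- χ₊ j) ℤ.* Cnj d j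
  S = ∑ (suc d) G
  halve : ∀ x → x ≡ (+ 1 / 2) ℚ.* (ι (+ 2) ℚ.* x)
  halve = ℚ-Solver.solve-∀ ℚ-ring
  distribute : ∀ s → (+ 1 / 2) ℚ.* (s ℚ.+ ι (+ 3)) ≡ (+ 1 / 2) ℚ.* s ℚ.+ (+ 3 / 2)
  distribute = ℚ-Solver.solve-∀ ℚ-ring

catalan-convolution-χ₋ : ∀ d →
  sumFT 0 d (λ k → ι (+ k) ℚ.* catalan (d ∸ k))
  ≡ sumFT 1 (suc d) (λ j → ι (leg3 (+ j ℤ.- + 1) ℤ.* (+ 2 ℤ.* binomℤ (2 ℕ.* d) (+ d ℤ.- + j) ℤ.- + suc d ℤ.* Cnj d j))) ℚ.- ι (+ d)
catalan-convolution-χ₋ d = begin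
  sumFT 0 d (λ k → ι (+ k) ℚ.* catalan (d ∸ k))  ≡⟨ sumFT-convolution d ⟩
  ι (convolution d)                              ≡⟨ cong ι (convolution-χ₋-identity d) ⟩
  ι (S ℤ.- + d)                                  ≡⟨ ι-- S (+ d) ⟩
  ι S ℚ.- ι (+ d)                                ≡⟨ cong (ℚ._- ι (+ d)) (sumFT-ι (suc d) F G (λ i → refl)) ⟨
  sumFT 1 (suc d) (λ j → ι (leg3 (+ j ℤ.- + 1) ℤ.* (+ 2 ℤ.* row d j ℤ.- + suc d ℤ.* Cnj d j))) ℚ.- ι (+ d) ∎
  where
  R = λ j → + 2 ℤ.* row d j ℤ.- + suc d ℤ.* Cnj d j
  F = λ j → ι (leg3 (+ j ℤ.- + 1) ℤ.* R j)
  G = λ j → χ₋ j ℤ.* R j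
  S = ∑ (suc d) G

catalan-convolution-χ₊ : ∀ d →
  sumFT 0 d (λ k → ι (+ k) ℚ.* catalan (d ∸ k))
  ≡ sumFT 1 (suc d) (λ j → ι (leg3 (+ j ℤ.+ + 1) ℤ.* (+ 2 ℤ.* binomℤ (2 ℕ.* d) (+ d ℤ.- + j) ℤ.- + suc d ℤ.* Cnj d j)))
    ℚ.+ ι (+ (2 ℕ.* d ℕ.+ 1))
catalan-convolution-χ₊ d = begin
  sumFT 0 d (λ k → ι (+ k) ℚ.* catalan (d ∸ k))  ≡⟨ sumFT-convolution d ⟩
  ι (convolution d)                              ≡⟨ cong ι (convolution-χ₊-identity d) ⟩
  ι (S ℤ.+ + (2 ℕ.* d ℕ.+ 1))                    ≡⟨ ι-+ S (+ (2 ℕ.* d ℕ.+ 1)) ⟩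
  ι S ℚ.+ ι (+ (2 ℕ.* d ℕ.+ 1))                  ≡⟨ cong (ℚ._+ ι (+ (2 ℕ.* d ℕ.+ 1))) (sumFT-ι (suc d) F G (λ i →
                                                      cong (λ w → ι (w ℤ.* R (suc i))) (leg3-+1 (suc i)))) ⟨
  sumFT 1 (suc d) (λ j → ι (leg3 (+ j ℤ.+ + 1) ℤ.* (+ 2 ℤ.* row d j ℤ.- + suc d ℤ.* Cnj d j))) ℚ.+ ι (+ (2 ℕ.* d ℕ.+ 1)) ∎
  where
  R = λ j → + 2 ℤ.* row d j ℤ.- + suc d ℤ.* Cnj d j
  F = λ j → ι (leg3 (+ j ℤ.+ + 1) ℤ.* R j)
  G = λ j → χ₊ j ℤ.* R j
  S = ∑ (suc d) G

∑-weighted-convolution : ∀ d →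
  ∑ d (λ k → (+ 3 ℤ.* + k ℤ.- + 2) ℤ.* cat (d ∸ k)) ≡ + 3 ℤ.* convolution d ℤ.- + 2 ℤ.* catalanPrefix d
∑-weighted-convolution d = begin
  ∑ d (λ k → (+ 3 ℤ.* + k ℤ.- + 2) ℤ.* cat (d ∸ k))
    ≡⟨ ∑-linear d (+ 3) (ℤ.- + 2) {λ k → + k ℤ.* cat (d ∸ k)} {λ k → cat (d ∸ k)} (λ i → split (+ suc i) (cat (d ∸ suc i))) ⟩
  + 3 ℤ.* convolution d ℤ.+ ℤ.- + 2 ℤ.* ∑ d (λ k → cat (d ∸ k))
    ≡⟨ cong (λ P → + 3 ℤ.* convolution d ℤ.+ ℤ.- + 2 ℤ.* P) (∑-cat-reversed d) ⟩
  + 3 ℤ.* convolution d ℤ.+ ℤ.- + 2 ℤ.* catalanPrefix d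
    ≡⟨ cong (ℤ._+_ (+ 3 ℤ.* convolution d)) (ℤP.neg-distribˡ-* (+ 2) (catalanPrefix d)) ⟨
  + 3 ℤ.* convolution d ℤ.- + 2 ℤ.* catalanPrefix d ∎
  where
  split : ∀ K c → (+ 3 ℤ.* K ℤ.- + 2) ℤ.* c ≡ + 3 ℤ.* (K ℤ.* c) ℤ.+ ℤ.- + 2 ℤ.* c
  split = solve-∀

third-catalan : ∀ k n → (ι (+ k) ℚ.- + 2 / 3) ℚ.* catalan n ≡ third ((+ 3 ℤ.* + k ℤ.- + 2) ℤ.* cat n)
third-catalan k n = begin
  (ι (+ k) ℚ.- + 2 / 3) ℚ.* catalan n
    ≡⟨ cong ((ι (+ k) ℚ.- + 2 / 3) ℚ.*_) (catalan≡ι-cat n) ⟩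
  (ι (+ k) ℚ.- + 2 / 3) ℚ.* ι (cat n)
    ≡⟨ rescale (ι (+ k)) (ι (cat n)) ⟩
  (+ 1 / 3) ℚ.* ((ι (+ 3) ℚ.* ι (+ k) ℚ.- ι (+ 2)) ℚ.* ι (cat n))
    ≡⟨ cong ((+ 1 / 3) ℚ.*_) (trans (ι-* (+ 3 ℤ.* + k ℤ.- + 2) (cat n))
                                    (cong (ℚ._* ι (cat n)) (trans (ι-- (+ 3 ℤ.* + k) (+ 2)) (cong (ℚ._- ι (+ 2)) (ι-* (+ 3) (+ k)))))) ⟨
  third ((+ 3 ℤ.* + k ℤ.- + 2) ℤ.* cat n) ∎
  where
  rescale : ∀ x y → (x ℚ.- + 2 / 3) ℚ.* y ≡ (+ 1 / 3) ℚ.* ((ι (+ 3) ℚ.* x ℚ.- ι (+ 2)) ℚ.* y)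
  rescale = ℚ-Solver.solve-∀ ℚ-ring

third-* : ∀ {w} u x → w ≡ third u → w ℚ.* ι x ≡ third (u ℤ.* x)
third-* u x refl = trans (ℚP.*-assoc (+ 1 / 3) (ι u) (ι x)) (cong ((+ 1 / 3) ℚ.*_) (sym (ι-* u x)))

-- Both sides are a third of an integer: 3·[j ≡ r (mod 3)] = 1 + W j.
catalan-convolution-residue : ∀ d (w : ℕ → ℚ) (W : ℕ → ℤ) K → (∀ j → w j ≡ third (+ 1 ℤ.+ W j)) →
  + 3 ℤ.* convolution d ℤ.- + 2 ℤ.* catalanPrefix d ≡ ∑ (suc d) (λ j → (+ j ℤ.* W j) ℤ.* Cnj d j) ℤ.+ K →
  sumFT 1 d (λ k → (ι (+ k) ℚ.- + 2 / 3) ℚ.* catalan (d ∸ k)) ℚ.+ (+ 1 / 3) ℚ.* sumFT 1 (suc d) (λ j → ι (+ j ℤ.* Cnj d j))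
  ≡ sumFT 1 (suc d) (λ j → w j ℚ.* ι (+ j ℤ.* Cnj d j)) ℚ.+ third K
catalan-convolution-residue d w W K w≡ identity = begin
  sumFT 1 d (λ k → (ι (+ k) ℚ.- + 2 / 3) ℚ.* catalan (d ∸ k)) ℚ.+ (+ 1 / 3) ℚ.* sumFT 1 (suc d) (λ j → ι (+ j ℤ.* Cnj d j))
    ≡⟨ cong₂ (λ x y → x ℚ.+ (+ 1 / 3) ℚ.* y)
             (sumFT-third d (λ k → (ι (+ k) ℚ.- + 2 / 3) ℚ.* catalan (d ∸ k)) (λ k → (+ 3 ℤ.* + k ℤ.- + 2) ℤ.* cat (d ∸ k))
                          (λ i → third-catalan (suc i) (d ∸ suc i)))
             (sumFT-ι (suc d) (λ j → ι (+ j ℤ.* Cnj d j)) (λ j → + j ℤ.* Cnj d j) (λ i → refl)) ⟩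
  third (∑ d (λ k → (+ 3 ℤ.* + k ℤ.- + 2) ℤ.* cat (d ∸ k))) ℚ.+ third J
    ≡⟨ cong (λ x → third x ℚ.+ third J) (trans (∑-weighted-convolution d) identity) ⟩
  third (SW ℤ.+ K) ℚ.+ third J
    ≡⟨ third-+ (SW ℤ.+ K) J ⟨
  third (SW ℤ.+ K ℤ.+ J)
    ≡⟨ cong third (regroup SW K J) ⟩
  third (+ 1 ℤ.* J ℤ.+ + 1 ℤ.* SW ℤ.+ K)
    ≡⟨ third-+ (+ 1 ℤ.* J ℤ.+ + 1 ℤ.* SW) K ⟩
  third (+ 1 ℤ.* J ℤ.+ + 1 ℤ.* SW) ℚ.+ third K
    ≡⟨ cong (λ x → third x ℚ.+ third K) (∑-linear (suc d) (+ 1) (+ 1) {λ j → + j ℤ.* Cnj d j} {λ j → (+ j ℤ.* W j) ℤ.* Cnj d j}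
                                          (λ i → split (+ suc i) (W (suc i)) (Cnj d (suc i)))) ⟨
  third (∑ (suc d) (λ j → (+ 1 ℤ.+ W j) ℤ.* (+ j ℤ.* Cnj d j))) ℚ.+ third K
    ≡⟨ cong (ℚ._+ third K) (sumFT-third (suc d) (λ j → w j ℚ.* ι (+ j ℤ.* Cnj d j)) (λ j → (+ 1 ℤ.+ W j) ℤ.* (+ j ℤ.* Cnj d j))
                                          (λ i → third-* (+ 1 ℤ.+ W (suc i)) (+ suc i ℤ.* Cnj d (suc i)) (w≡ (suc i)))) ⟨
  sumFT 1 (suc d) (λ j → w j ℚ.* ι (+ j ℤ.* Cnj d j)) ℚ.+ third K ∎
  where
  J = ∑ (suc d) (λ j → + j ℤ.* Cnj d j)
  SW = ∑ (suc d) (λ j → (+ j ℤ.* W j) ℤ.* Cnj d j)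
  regroup : ∀ S K J → S ℤ.+ K ℤ.+ J ≡ + 1 ℤ.* J ℤ.+ + 1 ℤ.* S ℤ.+ K
  regroup = solve-∀
  split : ∀ j a c → (+ 1 ℤ.+ a) ℤ.* (j ℤ.* c) ≡ + 1 ℤ.* (j ℤ.* c) ℤ.+ + 1 ℤ.* (j ℤ.* a ℤ.* c)
  split = solve-∀

catalan-convolution-residue₁ : ∀ d →
  sumFT 1 d (λ k → (ι (+ k) ℚ.- + 2 / 3) ℚ.* catalan (d ∸ k)) ℚ.+ (+ 1 / 3) ℚ.* sumFT 1 (suc d) (λ j → ι (+ j ℤ.* Cnj d j))
  ≡ sumFT 1 (suc d) (λ j → iv≡mod3 1 j ℚ.* ι (+ j ℤ.* Cnj d j)) ℚ.- ι (+ d) ℚ.+ + 2 / 3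
catalan-convolution-residue₁ d =
  trans (catalan-convolution-residue d (iv≡mod3 1) ψ (+ 2 ℤ.- + 3 ℤ.* + d) iv≡mod3-1-weight (convolution-ψ-identity d))
        (trans (cong (ℚ._+_ S) (cong ((+ 1 / 3) ℚ.*_) (trans (ι-- (+ 2) (+ 3 ℤ.* + d)) (cong (ℚ._-_ (ι (+ 2))) (ι-* (+ 3) (+ d))))))
               (rescale S (ι (+ d))))
  where
  S = sumFT 1 (suc d) (λ j → iv≡mod3 1 j ℚ.* ι (+ j ℤ.* Cnj d j))
  rescale : ∀ s x → s ℚ.+ (+ 1 / 3) ℚ.* (ι (+ 2) ℚ.- ι (+ 3) ℚ.* x) ≡ s ℚ.- x ℚ.+ + 2 / 3
  rescale = ℚ-Solver.solve-∀ ℚ-ring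

catalan-convolution-residue₂ : ∀ d →
  sumFT 1 d (λ k → (ι (+ k) ℚ.- + 2 / 3) ℚ.* catalan (d ∸ k)) ℚ.+ (+ 1 / 3) ℚ.* sumFT 1 (suc d) (λ j → ι (+ j ℤ.* Cnj d j))
  ≡ sumFT 1 (suc d) (λ j → iv≡mod3 2 j ℚ.* ι (+ j ℤ.* Cnj d j)) ℚ.+ ι (+ (2 ℕ.* d)) ℚ.- + 1 / 3
catalan-convolution-residue₂ d =
  trans (catalan-convolution-residue d (iv≡mod3 2) (λ j → ψ j ℤ.- + 3 ℤ.* χ j) (+ 3 ℤ.* + (2 ℕ.* d) ℤ.- + 1)
                                     iv≡mod3-2-weight (convolution-ψχ-identity d))
        (trans (cong (ℚ._+_ S) (cong ((+ 1 / 3) ℚ.*_) (trans (ι-- (+ 3 ℤ.* + (2 ℕ.* d)) (+ 1)) (cong (ℚ._- ι (+ 1)) (ι-* (+ 3) (+ (2 ℕ.* d)))))))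
               (rescale S (ι (+ (2 ℕ.* d)))))
  where
  S = sumFT 1 (suc d) (λ j → iv≡mod3 2 j ℚ.* ι (+ j ℤ.* Cnj d j))
  rescale : ∀ s x → s ℚ.+ (+ 1 / 3) ℚ.* (ι (+ 3) ℚ.* x ℚ.- ι (+ 1)) ≡ s ℚ.+ x ℚ.- + 1 / 3
  rescale = ℚ-Solver.solve-∀ ℚ-ring

theorem1p4 : (d δ : ℕ) → δ ℕ.≤ 1 →
    (catalan d ≡ ι (+ 1 ℤ.- + 2 ℤ.* + δ) ℚ.* sumLt d catalan
                 ℚ.+ ι ((ℤ.- + 1) ℤ.^ δ) ℚ.* sumFT 0 d (λ i → ι (leg3 (+ i ℤ.- + δ) ℤ.* Cnj d (suc i)))
                 ℚ.+ ι (+ 1 ℤ.+ + δ))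
    × (catalan d ≡ (+ 1 / 2) ℚ.* sumFT 1 (suc d) (λ j → (ℚ.1ℚ ℚ.- ι (+ 3) ℚ.* iv3∣ j) ℚ.* ι (Cnj d j))
                   ℚ.+ (+ 3 / 2))
    × (sumFT 0 d (λ k → ι (+ k) ℚ.* catalan (d ∸ k))
       ≡ sumFT 1 (suc d) (λ j → ι (leg3 (+ j ℤ.- + 1) ℤ.* (+ 2 ℤ.* binomℤ (2 ℕ.* d) (+ d ℤ.- + j) ℤ.- + suc d ℤ.* Cnj d j)))
         ℚ.- ι (+ d))
    × (sumFT 0 d (λ k → ι (+ k) ℚ.* catalan (d ∸ k))
       ≡ sumFT 1 (suc d) (λ j → ι (leg3 (+ j ℤ.+ + 1) ℤ.* (+ 2 ℤ.* binomℤ (2 ℕ.* d) (+ d ℤ.- + j) ℤ.- + suc d ℤ.* Cnj d j)))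
         ℚ.+ ι (+ (2 ℕ.* d ℕ.+ 1)))
    × (sumFT 1 d (λ k → (ι (+ k) ℚ.- + 2 / 3) ℚ.* catalan (d ∸ k))
         ℚ.+ (+ 1 / 3) ℚ.* sumFT 1 (suc d) (λ j → ι (+ j ℤ.* Cnj d j))
       ≡ sumFT 1 (suc d) (λ j → iv≡mod3 1 j ℚ.* ι (+ j ℤ.* Cnj d j)) ℚ.- ι (+ d) ℚ.+ + 2 / 3)
    × (sumFT 1 d (λ k → (ι (+ k) ℚ.- + 2 / 3) ℚ.* catalan (d ∸ k))
         ℚ.+ (+ 1 / 3) ℚ.* sumFT 1 (suc d) (λ j → ι (+ j ℤ.* Cnj d j))
       ≡ sumFT 1 (suc d) (λ j → iv≡mod3 2 j ℚ.* ι (+ j ℤ.* Cnj d j)) ℚ.+ ι (+ (2 ℕ.* d)) ℚ.- + 1 / 3)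
theorem1p4 d δ δ≤1 =
  catalan-χ-identity d δ δ≤1 ,
  catalan-mod3-identity d ,
  catalan-convolution-χ₋ d ,
  catalan-convolution-χ₊ d ,
  catalan-convolution-residue₁ d ,
  catalan-convolution-residue₂ d
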